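{- Let $n$ be a positive integer and let $v_0$ be a vertex not in $K_n$. Let $H$ be a simple graph formed from the disjoint union $K_n\cup\{v_0\}$ by joining some of the vertices of $K_n$ to $v_0$. Let $R$ be the set of vertices of $H$ adjacent to $v_0$, let $S=V(H)\setminus(R\cup\{v_0\})$ be the set of vertices other than $v_0$ that are not adjacent to $v_0$, and put $r=|R|$, $s=|S|$ (so $r+s=n$). Let $G$ be a simple graph. Then $G$ is isomorphic to $H$ if and only if $$\begin{aligned}da(G;x,y)=\ &(1+xy^{2})\,da(K_{r};x,y) + y\, da(K_{s};x,y) + y\, da(K_{r};x,y)\,da(K_{s};x,y)\\ &+ xy^{n+1-r} + xy\, da(K_{r};x,y)\sum_{j=1}^{s}\binom{s}{j}x^{j}y^{\min\{2j,\,s+1\}}.\end{aligned}$$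
   Context: All graphs are finite and simple. For a graph $G$, $S\subseteq V(G)$ and $u\in V(G)$, let $\bar S=V(G)\setminus S$, let $\delta_S(u)=|\{v\in S:\{u,v\}\in E(G)\}|$, and let $G[S]$ be the subgraph induced by $S$. The defensive alliance polynomial of $G$ is $$da(G;x,y)=\sum_{S} x^{|S|}\,y^{f_y(S)},\qquad f_y(S)=\min_{u\in S}\bigl(\delta_S(u)-\delta_{\bar S}(u)+|V(G)|\bigr),$$ where the sum runs over all non-empty $S\subseteq V(G)$ such that $G[S]$ is connected (single-vertex graphs are connected). $K_m$ is the complete graph on $m$ vertices; for $m=0$ the sum is empty, so $da(K_0;x,y)=0$. -}

module Defs where

open import Data.Fin using (Fin; zero; suc)
open import Data.Fin.Properties using (_≟_; all?)
open import Data.Fin.Subset using (Subset; inside; outside; _∈_; _∩_; ∁; ∣_∣; Nonempty)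
open import Data.Fin.Subset.Properties using (_∈?_; nonempty?)
open import Data.List using (List; []; _∷_; _++_; map; concatMap; filter; allFin; applyUpTo; cartesianProductWith; sum)
open import Data.List.Extrema.Nat using (min)
import Data.List.Membership.Propositional as List
open import Data.List.Membership.Propositional.Properties using (∈-allFin)
open import Data.List.Relation.Unary.Any using (here; there)
open import Data.Nat using (ℕ; zero; suc; _+_; _*_; _∸_)
import Data.Nat.Properties as ℕ
open import Data.Product using (_×_; _,_; proj₁; proj₂)
open import Data.Sum using (_⊎_; inj₁; inj₂)
import Data.Vec as Vec
open import Function.Bundles using (_↔_; _⇔_; Inverse)
open import Level using (0ℓ)
open import Relation.Binary using (Rel; Decidable; Symmetric; Irreflexive)
open import Relation.Binary.Construct.Closure.ReflexiveTransitive using (Star; ε; _◅_; _◅◅_)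
open import Relation.Binary.PropositionalEquality using (_≡_; _≢_; refl; sym)
open import Relation.Nullary using (Dec; yes; no; does; ¬?; map′; _×-dec_; _⊎-dec_; _→-dec_)

private
  variable
    m n : ℕ

------------------------------------------------------------------------
-- Finite simple graphs

record Graph (n : ℕ) : Set₁ where
  field
    Adj        : Rel (Fin n) 0ℓ
    adj?       : Decidable Adj
    adj-sym    : Symmetric Adj
    adj-irrefl : Irreflexive _≡_ Adj

open Graph public

record _≅_ (G : Graph m) (H : Graph n) : Set where
  field
    bijection : Fin m ↔ Fin n
    adj-iff   : ∀ u v → Adj G u v ⇔ Adj H (Inverse.to bijection u) (Inverse.to bijection v)

infix 4 _≅_

complete : ∀ n → Graph n
complete n = record
  { Adj        = _≢_
  ; adj?       = λ u v → ¬? (u ≟ v)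
  ; adj-sym    = λ u≢v v≡u → u≢v (sym v≡u)
  ; adj-irrefl = λ u≡v u≢v → u≢v u≡v
  }

-- The disjoint union of G and one new vertex, namely zero, with that vertex
-- joined to the vertices of G in J.  The old vertex u of G becomes suc u.
module _ (G : Graph n) (J : Subset n) where

  data AddVertexAdj : Rel (Fin (suc n)) 0ℓ where
    old   : ∀ {u v} → Adj G u v → AddVertexAdj (suc u) (suc v)
    new-l : ∀ {u} → u ∈ J → AddVertexAdj zero (suc u)
    new-r : ∀ {u} → u ∈ J → AddVertexAdj (suc u) zero

  addVertex : Graph (suc n)
  addVertex = record
    { Adj        = AddVertexAdj
    ; adj?       = dec
    ; adj-sym    = symm
    ; adj-irrefl = irrefl
    }
    where
    dec : Decidable AddVertexAdj
    dec zero    zero    = no λ ()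
    dec zero    (suc v) = map′ new-l (λ { (new-l p) → p }) (v ∈? J)
    dec (suc u) zero    = map′ new-r (λ { (new-r p) → p }) (u ∈? J)
    dec (suc u) (suc v) = map′ old (λ { (old p) → p }) (adj? G u v)

    symm : Symmetric AddVertexAdj
    symm (old p)   = old (adj-sym G p)
    symm (new-l p) = new-r p
    symm (new-r p) = new-l p

    irrefl : Irreflexive _≡_ AddVertexAdj
    irrefl refl (old p) = adj-irrefl G refl p

neighbourhood : Graph n → Fin n → Subset n
neighbourhood G u = Vec.tabulate λ v → does (adj? G u v)

------------------------------------------------------------------------
-- Connectedness of induced subgraphs

InducedAdj : Graph n → Subset n → Rel (Fin n) 0ℓ
InducedAdj G S u v = u ∈ S × v ∈ S × Adj G u v

Connected : Graph n → Subset n → Set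
Connected G S = ∀ u v → u ∈ S → v ∈ S → Star (InducedAdj G S) u v

-- Reachability in a decidable relation on Fin n is decidable (Warshall).
module _ {R : Rel (Fin n) 0ℓ} (R? : Decidable R) where
  private
    -- Walks all of whose intermediate vertices lie in the given list.
    Via : List (Fin n) → Rel (Fin n) 0ℓ
    Via []       u v = u ≡ v ⊎ R u v
    Via (w ∷ ws) u v = Via ws u v ⊎ (Via ws u w × Via ws w v)

    via? : ∀ ws → Decidable (Via ws)
    via? []       u v = (u ≟ v) ⊎-dec R? u v
    via? (w ∷ ws) u v = via? ws u v ⊎-dec (via? ws u w ×-dec via? ws w v)

    sound : ∀ ws {u v} → Via ws u v → Star R u v
    sound []       (inj₁ refl)    = ε
    sound []       (inj₂ r)       = r ◅ ε
    sound (w ∷ ws) (inj₁ p)       = sound ws p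
    sound (w ∷ ws) (inj₂ (p , q)) = sound ws p ◅◅ sound ws q

    via-refl : ∀ ws {u} → Via ws u u
    via-refl []       = inj₁ refl
    via-refl (w ∷ ws) = inj₁ (via-refl ws)

    via-step : ∀ ws {u v} → R u v → Via ws u v
    via-step []       r = inj₂ r
    via-step (w ∷ ws) r = inj₁ (via-step ws r)

    to-head : ∀ ws {u w} → Via (w ∷ ws) u w → Via ws u w
    to-head ws (inj₁ p)       = p
    to-head ws (inj₂ (p , _)) = p

    from-head : ∀ ws {w v} → Via (w ∷ ws) w v → Via ws w v
    from-head ws (inj₁ p)       = p
    from-head ws (inj₂ (_ , p)) = p

    via-trans : ∀ ws {u w v} → w List.∈ ws → Via ws u w → Via ws w v → Via ws u v
    via-trans (_ ∷ ws) (here refl) p q = inj₂ (to-head ws p , from-head ws q)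
    via-trans (_ ∷ ws) (there i) (inj₁ p)       (inj₁ q)       = inj₁ (via-trans ws i p q)
    via-trans (_ ∷ ws) (there i) (inj₁ p)       (inj₂ (q , s)) = inj₂ (via-trans ws i p q , s)
    via-trans (_ ∷ ws) (there i) (inj₂ (p , q)) (inj₁ s)       = inj₂ (p , via-trans ws i q s)
    via-trans (_ ∷ ws) (there i) (inj₂ (p , _)) (inj₂ (_ , s)) = inj₂ (p , s)

    complete-via : ∀ {u v} → Star R u v → Via (allFin n) u v
    complete-via ε        = via-refl (allFin n)
    complete-via (r ◅ rs) =
      via-trans (allFin n) (∈-allFin _) (via-step (allFin n) r) (complete-via rs)

  star? : Decidable (Star R)
  star? u v = map′ (sound (allFin n)) complete-via (via? (allFin n) u v)

inducedAdj? : (G : Graph n) (S : Subset n) → Decidable (InducedAdj G S)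
inducedAdj? G S u v = (u ∈? S) ×-dec (v ∈? S) ×-dec adj? G u v

connected? : (G : Graph n) (S : Subset n) → Dec (Connected G S)
connected? G S = all? λ u → all? λ v →
  (u ∈? S) →-dec ((v ∈? S) →-dec star? (inducedAdj? G S) u v)

------------------------------------------------------------------------
-- Bivariate polynomials

-- A formal sum of terms c xⁱ yʲ, each given as (c , i , j).  Exponents may
-- repeat, so polynomials are compared by _≈ₚ_ and not by _≡_.
Poly : Set
Poly = List (ℕ × ℕ × ℕ)

coeff : Poly → ℕ → ℕ → ℕ
coeff []                _ _ = 0
coeff ((c , a , b) ∷ p) i j with (a ℕ.≟ i) ×-dec (b ℕ.≟ j)
... | yes _ = c + coeff p i j
... | no  _ = coeff p i j

infix 4 _≈ₚ_
_≈ₚ_ : Poly → Poly → Set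
p ≈ₚ q = ∀ i j → coeff p i j ≡ coeff q i j

const : ℕ → Poly
const c = (c , 0 , 0) ∷ []

infix 8 x^_y^_
x^_y^_ : ℕ → ℕ → Poly
x^ i y^ j = (1 , i , j) ∷ []

infixl 6 _+ₚ_
_+ₚ_ : Poly → Poly → Poly
_+ₚ_ = _++_

infixl 7 _*ₚ_
_*ₚ_ : Poly → Poly → Poly
_*ₚ_ = cartesianProductWith λ (c , a , b) (d , a′ , b′) → c * d , a + a′ , b + b′

∑ₚ : {A : Set} → List A → (A → Poly) → Poly
∑ₚ xs f = concatMap f xs

[1⋯_] : ℕ → List ℕ
[1⋯ k ] = applyUpTo suc k

------------------------------------------------------------------------
-- The defensive alliance polynomial

-- The number of neighbours of u in S.
δ : Graph n → Subset n → Fin n → ℕ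
δ G S u = ∣ S ∩ neighbourhood G u ∣

-- The value 0 at [] is never used below.
minimum : List ℕ → ℕ
minimum []       = 0
minimum (k ∷ ks) = min k ks

-- Since δ G (∁ S) u ≤ n, the truncated subtraction agrees with that of ℤ.
f-y : Graph n → Subset n → ℕ
f-y {n} G S = minimum (map (λ u → (δ G S u + n) ∸ δ G (∁ S) u) (filter (_∈? S) (allFin n)))

subsets : ∀ n → List (Subset n)
subsets zero    = Vec.[] ∷ []
subsets (suc n) = map (inside Vec.∷_) (subsets n) ++ map (outside Vec.∷_) (subsets n)

connectedSubsets : Graph n → List (Subset n)
connectedSubsets {n} G = filter (λ S → nonempty? S ×-dec connected? G S) (subsets n)

da : Graph n → Poly
da G = ∑ₚ (connectedSubsets G) λ S → x^ ∣ S ∣ y^ f-y G S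

module Submission where

open import Algebra.Properties.CommutativeMonoid.Sum using (sum-cong-≗; sum-permute; sum-remove; sum-replicate-zero)
open import Algebra.Properties.CommutativeSemigroup using (interchange; x∙yz≈y∙xz)
open import Data.Bool using (Bool; true; false; if_then_else_; not; _∧_)
open import Data.Fin using (Fin; zero; suc; punchIn)
import Data.Fin.Properties as Fin
open import Data.Fin.Permutation as Perm using (Permutation; _⟨$⟩ʳ_; _⟨$⟩ˡ_; inverseˡ; inverseʳ; flip)
open import Data.Fin.Subset using (Subset; inside; outside; ∁; _∩_; _∪_; ∣_∣; ⁅_⁆; ⊥; ⊤; _∈_; _∉_; Nonempty)
open import Data.Fin.Subset.Properties using (_∈?_; nonempty?; x∈p∩q⁺; x∈p∩q⁻; x∉p⇒x∈∁p; x∈∁p⇒x∉p; x∈⁅x⁆; x∈⁅y⁆⇒x≡y; ∩-comm; ∩-zeroˡ; ∩-identityˡ; ∪-identityʳ; ∣⊥∣≡0; ∣⊤∣≡n; ∣⁅x⁆∣≡1; ∣p∣≤n; Empty-unique; ∈⊤; p⊂q⇒∣p∣<∣q∣)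
open import Data.List using (List; []; _∷_; _++_; map; filter; allFin; applyUpTo)
open import Data.List.Extrema.Nat using (min≤v⁺; argmin-sel)
import Data.List.Membership.Propositional as List
open import Data.List.Membership.Propositional.Properties using (∈-allFin; ∈-map⁺; ∈-map⁻; ∈-filter⁺; ∈-filter⁻; ∈-++⁺ˡ; ∈-++⁺ʳ)
open import Data.List.Membership.Propositional.Properties.WithK using (unique∧set⇒bag)
open import Data.List.Properties using (map-++; map-∘; map-cong; map-applyUpTo)
open import Data.List.Relation.Binary.BagAndSetEquality using (∼bag⇒↭)
open import Data.List.Relation.Binary.Permutation.Propositional using (_↭_)
import Data.List.Relation.Binary.Permutation.Propositional.Properties as ↭
import Data.List.Relation.Unary.All as All
import Data.List.Relation.Unary.AllPairs as AllPairs
open import Data.List.Relation.Unary.Any as Any using (here; there)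
open import Data.List.Relation.Unary.Unique.Propositional using (Unique)
import Data.List.Relation.Unary.Unique.Propositional.Properties as Unique
open import Data.Nat using (ℕ; zero; suc; _+_; _*_; _∸_; _⊓_; _≤_; _<_; s≤s; NonZero)
open import Data.Nat.Combinatorics using (_C_; nCk+nC[k+1]≡[n+1]C[k+1])
open import Data.Nat.ListAction using (sum)
open import Data.Nat.ListAction.Properties using (sum-++; sum-↭)
open import Data.Nat.Properties
open import Data.Nat.Tactic.RingSolver using (solve-∀)
open import Data.Product using (_×_; _,_; ∃; proj₁; proj₂)
open import Data.Sum using (_⊎_; inj₁; inj₂)
import Data.Vec as Vec
open import Data.Vec using (lookup; _∷_; here; there)
open import Data.Vec.Properties using (lookup∘tabulate; lookup-map; lookup-replicate; lookup-zipWith; lookup⇒[]=; []=⇒lookup; tabulate∘lookup; tabulate-cong; ∷-injectiveʳ)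
open import Function using (_∘_; id; _⇔_; mk⇔; Equivalence)
open import Function.Construct.Composition using (_⇔-∘_)
open import Relation.Binary.Construct.Closure.ReflexiveTransitive using (Star; ε; _◅_; _◅◅_; gmap)
open import Relation.Binary.PropositionalEquality
open import Relation.Nullary using (Dec; yes; no; does; ¬_; contradiction; _×-dec_)
open import Relation.Nullary.Decidable using (dec-true; dec-false; does-⇔)
open import Defs

-- A polynomial Σ c xᵃ yᵇ is read as the linear functional φ ↦ Σ c φ(a, b).  The
-- connectedness and the weight f_y of a subset X of H depend only on whether
-- v₀ ∈ X, on a = ∣X ∩ R∣ and on b = ∣X ∩ S∣; summing over X according to
-- whether a and b vanish gives the terms of the formula.  Conversely, a
-- one-vertex subset {u} contributes x y^(∣V∣ − deg u), so the coefficients of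
-- x¹ determine the degree sequence, and every degree-preserving bijection from
-- G to H is an isomorphism.

-- Exponents may repeat in a `Poly`, so the two sides of the formula cannot be compared entry by
-- entry. Under a functional a product becomes a nested sum with shifted arguments of φ, so no
-- convolution of coefficients arises, and both sides turn into sums over the sizes a and b. Taking
-- for φ the indicator of one monomial gives back the coefficient. In the converse the order of G is
-- not known beforehand, and the coefficients of x¹ see only differences between order and degree.
-- They also count the vertices, so equality of the orders comes out together with the bijection.
-- The formula itself enters the converse only as another expression for `da` of H.

private
  variable
    A B : Set
    m n : ℕ

open Algebra.Properties.CommutativeMonoid.Sum +-0-commutativeMonoid using () renaming (sum to ∑Fin)

-- Finite sums over lists and over all subsets.

∑ : List A → (A → ℕ) → ℕ
∑ xs f = sum (map f xs)

∑-cong : (xs : List A) {f g : A → ℕ} → (∀ x → f x ≡ g x) → ∑ xs f ≡ ∑ xs g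
∑-cong xs f≗g = cong sum (map-cong f≗g xs)

∑-map : (g : A → B) (xs : List A) {f : B → ℕ} → ∑ (map g xs) f ≡ ∑ xs (f ∘ g)
∑-map g xs = cong sum (sym (map-∘ xs))

∑-++ : (xs ys : List A) {f : A → ℕ} → ∑ (xs ++ ys) f ≡ ∑ xs f + ∑ ys f
∑-++ xs ys {f} = trans (cong sum (map-++ f xs ys)) (sum-++ (map f xs) (map f ys))

∑-distrib-+ : (xs : List A) {f g : A → ℕ} → ∑ xs (λ x → f x + g x) ≡ ∑ xs f + ∑ xs g
∑-distrib-+ []       = refl
∑-distrib-+ (x ∷ xs) {f} {g} =
  trans (cong (f x + g x +_) (∑-distrib-+ xs)) (interchange +-commutativeSemigroup (f x) (g x) _ _)

∑-zero : (xs : List A) {f : A → ℕ} → (∀ x → f x ≡ 0) → ∑ xs f ≡ 0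
∑-zero []       f≗0 = refl
∑-zero (x ∷ xs) f≗0 = cong₂ _+_ (f≗0 x) (∑-zero xs f≗0)

*-distribˡ-∑ : ∀ c (xs : List A) {f : A → ℕ} → c * ∑ xs f ≡ ∑ xs (λ x → c * f x)
*-distribˡ-∑ c []       = *-zeroʳ c
*-distribˡ-∑ c (x ∷ xs) = trans (*-distribˡ-+ c _ _) (cong (_ +_) (*-distribˡ-∑ c xs))

∑-filter : {P : A → Set} (P? : ∀ x → Dec (P x)) (xs : List A) {f : A → ℕ} →
           ∑ (filter P? xs) f ≡ ∑ xs (λ x → if does (P? x) then f x else 0)
∑-filter P? []       = refl
∑-filter P? (x ∷ xs) with does (P? x)
... | true  = cong (_ +_) (∑-filter P? xs)
... | false = ∑-filter P? xs

∑-subsets : (F : Subset (suc n) → ℕ) →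
  ∑ (subsets (suc n)) F ≡ ∑ (subsets n) (F ∘ (inside Vec.∷_)) + ∑ (subsets n) (F ∘ (outside Vec.∷_))
∑-subsets {n} F = trans (∑-++ (map (inside Vec.∷_) (subsets n)) _)
  (cong₂ _+_ (∑-map _ (subsets n)) (∑-map _ (subsets n)))

-- Polynomials as linear functionals.

⟦_⟧ : Poly → (ℕ → ℕ → ℕ) → ℕ
⟦ p ⟧ φ = ∑ p λ (c , a , b) → c * φ a b

indicator : {P : Set} → Dec P → ℕ
indicator (yes _) = 1
indicator (no  _) = 0

monomialIndicator : ℕ → ℕ → ℕ → ℕ → ℕ
monomialIndicator i j a b = indicator ((a ≟ i) ×-dec (b ≟ j))

coeff-⟦⟧ : ∀ p i j → coeff p i j ≡ ⟦ p ⟧ (monomialIndicator i j)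
coeff-⟦⟧ []                i j = refl
coeff-⟦⟧ ((c , a , b) ∷ p) i j with (a ≟ i) ×-dec (b ≟ j)
... | yes _ = cong₂ _+_ (sym (*-identityʳ c)) (coeff-⟦⟧ p i j)
... | no  _ = trans (coeff-⟦⟧ p i j) (cong (_+ ⟦ p ⟧ (monomialIndicator i j)) (sym (*-zeroʳ c)))

⟦⟧-cong : ∀ p {φ ψ} → (∀ a b → φ a b ≡ ψ a b) → ⟦ p ⟧ φ ≡ ⟦ p ⟧ ψ
⟦⟧-cong p φ≗ψ = ∑-cong p λ (c , a , b) → cong (c *_) (φ≗ψ a b)

⟦⟧-+ₚ : ∀ p q {φ} → ⟦ p +ₚ q ⟧ φ ≡ ⟦ p ⟧ φ + ⟦ q ⟧ φ
⟦⟧-+ₚ p q = ∑-++ p q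

⟦⟧-monomial : ∀ c a b {φ} → ⟦ (c , a , b) ∷ [] ⟧ φ ≡ c * φ a b
⟦⟧-monomial c a b = +-identityʳ _

⟦⟧-*ₚ : ∀ p q {φ} → ⟦ p *ₚ q ⟧ φ ≡ ⟦ p ⟧ λ a b → ⟦ q ⟧ λ a′ b′ → φ (a + a′) (b + b′)
⟦⟧-*ₚ []                q     = refl
⟦⟧-*ₚ ((c , a , b) ∷ p) q {φ} = trans (∑-++ (map _ q) (p *ₚ q)) (cong₂ _+_ head (⟦⟧-*ₚ p q))
  where
  open ≡-Reasoning
  shifted : ℕ × ℕ × ℕ → ℕ
  shifted (d , a′ , b′) = d * φ (a + a′) (b + b′)

  head : ∑ (map _ q) _ ≡ c * ∑ q shifted
  head = begin
    ∑ (map _ q) _              ≡⟨ ∑-map _ q ⟩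
    ∑ q _                      ≡⟨ ∑-cong q (λ (d , _) → *-assoc c d _) ⟩
    ∑ q (λ t → c * shifted t)  ≡⟨ *-distribˡ-∑ c q ⟨
    c * ∑ q shifted            ∎

⟦⟧-∑ₚ : (xs : List A) (f : A → Poly) {φ : ℕ → ℕ → ℕ} → ⟦ ∑ₚ xs f ⟧ φ ≡ ∑ xs λ x → ⟦ f x ⟧ φ
⟦⟧-∑ₚ []       f = refl
⟦⟧-∑ₚ (x ∷ xs) f = trans (∑-++ (f x) (∑ₚ xs f)) (cong (_ +_) (⟦⟧-∑ₚ xs f))

-- Sums over subsets by cardinality, and binomial coefficients.

-- The sum of ψ ∣ A ∣ over all subsets A of an s-element set.
sizeSum : ℕ → (ℕ → ℕ) → ℕ
sizeSum zero    ψ = ψ 0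
sizeSum (suc s) ψ = sizeSum s (ψ ∘ suc) + sizeSum s ψ

-- Encodes the exclusion of the empty set in the summand, so that the index still ranges over all
-- subsets and `sizeSum` keeps its simple recursion.
onPositive : (ℕ → ℕ) → ℕ → ℕ
onPositive ψ zero    = 0
onPositive ψ (suc k) = ψ (suc k)

onPositive-cong : ∀ {ψ χ} → (∀ k → ψ (suc k) ≡ χ (suc k)) → ∀ k → onPositive ψ k ≡ onPositive χ k
onPositive-cong ψ≗χ zero    = refl
onPositive-cong ψ≗χ (suc k) = ψ≗χ k

sizeSum-cong : ∀ s {ψ χ} → (∀ k → ψ k ≡ χ k) → sizeSum s ψ ≡ sizeSum s χ
sizeSum-cong zero    ψ≗χ = ψ≗χ 0
sizeSum-cong (suc s) ψ≗χ = cong₂ _+_ (sizeSum-cong s (ψ≗χ ∘ suc)) (sizeSum-cong s ψ≗χ)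

sizeSum-distrib-+ : ∀ s {ψ χ} → sizeSum s (λ k → ψ k + χ k) ≡ sizeSum s ψ + sizeSum s χ
sizeSum-distrib-+ zero    = refl
sizeSum-distrib-+ (suc s) {ψ} {χ} =
  trans (cong₂ _+_ (sizeSum-distrib-+ s) (sizeSum-distrib-+ s))
        (interchange +-commutativeSemigroup (sizeSum s (ψ ∘ suc)) _ _ _)

-- Only the empty set has size 0. Since `onPositive ψ ∘ suc` is `ψ ∘ suc` by computation, the
-- induction hypothesis is needed for the second summand alone.
sizeSum-split : ∀ s ψ → sizeSum s ψ ≡ ψ 0 + sizeSum s (onPositive ψ)
sizeSum-split zero    ψ = sym (+-identityʳ (ψ 0))
sizeSum-split (suc s) ψ = begin
  sizeSum s (ψ ∘ suc) + sizeSum s ψ                         ≡⟨ cong (sizeSum s (ψ ∘ suc) +_) (sizeSum-split s ψ) ⟩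
  sizeSum s (ψ ∘ suc) + (ψ 0 + sizeSum s (onPositive ψ))    ≡⟨ +-assoc (sizeSum s (ψ ∘ suc)) (ψ 0) _ ⟨
  sizeSum s (ψ ∘ suc) + ψ 0 + sizeSum s (onPositive ψ)      ≡⟨ cong (_+ sizeSum s (onPositive ψ)) (+-comm (sizeSum s (ψ ∘ suc)) (ψ 0)) ⟩
  ψ 0 + sizeSum s (ψ ∘ suc) + sizeSum s (onPositive ψ)      ≡⟨ +-assoc (ψ 0) (sizeSum s (ψ ∘ suc)) _ ⟩
  ψ 0 + (sizeSum s (ψ ∘ suc) + sizeSum s (onPositive ψ))    ∎
  where open ≡-Reasoning

-- The upper limit N is arbitrary above s since s C j = 0 for j > s.
sizeSum-binomial : ∀ s {N} ψ → s < N → sizeSum s ψ ≡ sum (applyUpTo (λ j → (s C j) * ψ j) N)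
sizeSum-binomial zero {suc N} ψ _ = sym (begin
  1 * ψ 0 + sum (applyUpTo (λ j → 0 * ψ (suc j)) N) ≡⟨ cong₂ _+_ (*-identityˡ (ψ 0)) (zeros N) ⟩
  ψ 0 + 0                                           ≡⟨ +-identityʳ (ψ 0) ⟩
  ψ 0                                               ∎)
  where
  open ≡-Reasoning
  zeros : ∀ N → sum (applyUpTo (λ _ → 0) N) ≡ 0
  zeros zero    = refl
  zeros (suc N) = zeros N
sizeSum-binomial (suc s) {suc N} ψ (s≤s s<N) = begin
  sizeSum s (ψ ∘ suc) + sizeSum s ψ
    -- Lining up the terms for Pascal's rule takes the limit N in the first sum and N + 1 in the
    -- second, whose term for j = 0 is then split off. This is why N is not tied to s.
    ≡⟨ cong₂ _+_ (sizeSum-binomial s (ψ ∘ suc) s<N) (sizeSum-binomial s ψ (m<n⇒m<1+n s<N)) ⟩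
  sum (applyUpTo (λ j → (s C j) * ψ (suc j)) N) + (ψ₀ + sum (applyUpTo (λ j → (s C suc j) * ψ (suc j)) N))
    ≡⟨ x∙yz≈y∙xz +-commutativeSemigroup (sum (applyUpTo (λ j → (s C j) * ψ (suc j)) N)) ψ₀ _ ⟩
  ψ₀ + (sum (applyUpTo (λ j → (s C j) * ψ (suc j)) N) + sum (applyUpTo (λ j → (s C suc j) * ψ (suc j)) N))
    ≡⟨ cong (ψ₀ +_) (pascal (λ j → ψ (suc j)) N (λ j → s C j) _ _ (λ j → nCk+nC[k+1]≡[n+1]C[k+1] s j)) ⟩
  ψ₀ + sum (applyUpTo (λ j → (suc s C suc j) * ψ (suc j)) N)
    ∎
  where
  open ≡-Reasoning
  ψ₀ = 1 * ψ 0
  pascal : ∀ (χ : ℕ → ℕ) N (f g h : ℕ → ℕ) → (∀ j → f j + g j ≡ h j) →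
    sum (applyUpTo (λ j → f j * χ j) N) + sum (applyUpTo (λ j → g j * χ j) N) ≡
    sum (applyUpTo (λ j → h j * χ j) N)
  pascal χ zero    f g h f+g≗h = refl
  pascal χ (suc N) f g h f+g≗h = trans
    (interchange +-commutativeSemigroup (f 0 * χ 0) _ (g 0 * χ 0) _)
    (cong₂ _+_ (trans (sym (*-distribʳ-+ (χ 0) (f 0) (g 0))) (cong (_* χ 0) (f+g≗h 0)))
               (pascal (χ ∘ suc) N (f ∘ suc) (g ∘ suc) (h ∘ suc) (f+g≗h ∘ suc)))

∑-binomial : ∀ s ψ → ∑ [1⋯ s ] (λ j → (s C j) * ψ j) ≡ sizeSum s (onPositive ψ)
∑-binomial s ψ = begin
  ∑ [1⋯ s ] (λ j → (s C j) * ψ j)                          ≡⟨ cong sum (map-applyUpTo suc _ s) ⟩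
  sum (applyUpTo (λ j → (s C suc j) * ψ (suc j)) s)         ≡⟨⟩
  -- The new term for j = 0 vanishes because `onPositive ψ 0` is 0.
  sum (applyUpTo (λ j → (s C j) * onPositive ψ j) (suc s))  ≡⟨ sizeSum-binomial s (onPositive ψ) (n<1+n s) ⟨
  sizeSum s (onPositive ψ)                               ∎
  where open ≡-Reasoning

-- Each vertex is charged to the outer sum if it lies in J and to the inner sum otherwise, so the
-- two parts of X are chosen independently.
∑-subsets-split : (J : Subset n) (F : ℕ → ℕ → ℕ) →
  ∑ (subsets n) (λ X → F ∣ X ∩ J ∣ ∣ X ∩ ∁ J ∣) ≡ sizeSum ∣ J ∣ λ a → sizeSum ∣ ∁ J ∣ λ b → F a b
∑-subsets-split Vec.[] F = +-identityʳ _
∑-subsets-split {suc n} (inside Vec.∷ J) F = trans (∑-subsets {n} _)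
  (cong₂ _+_ (∑-subsets-split J (F ∘ suc)) (∑-subsets-split J F))
∑-subsets-split {suc n} (outside Vec.∷ J) F = trans (∑-subsets {n} _)
  (trans (cong₂ _+_ (∑-subsets-split J (λ a → F a ∘ suc)) (∑-subsets-split J F))
         (sym (sizeSum-distrib-+ ∣ J ∣)))

∑-subsets-size : ∀ n ψ → ∑ (subsets n) (λ X → ψ ∣ X ∣) ≡ sizeSum n ψ
∑-subsets-size zero    ψ = +-identityʳ (ψ 0)
∑-subsets-size (suc n) ψ = trans (∑-subsets {n} _) (cong₂ _+_ (∑-subsets-size n (ψ ∘ suc)) (∑-subsets-size n ψ))

-- Enumeration of subsets and transport along permutations.

lookup-ext : {S T : Subset n} → (∀ i → lookup S i ≡ lookup T i) → S ≡ T
lookup-ext {S = S} {T} S≗T = trans (sym (tabulate∘lookup S)) (trans (tabulate-cong S≗T) (tabulate∘lookup T))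

∈-subsets : (S : Subset n) → S List.∈ subsets n
∈-subsets Vec.[]                = here refl
∈-subsets (inside Vec.∷ S)      = ∈-++⁺ˡ (∈-map⁺ _ (∈-subsets S))
∈-subsets {suc n} (outside Vec.∷ S) = ∈-++⁺ʳ (map (inside Vec.∷_) (subsets n)) (∈-map⁺ _ (∈-subsets S))

subsets-unique : ∀ n → Unique (subsets n)
subsets-unique zero    = All.[] AllPairs.∷ AllPairs.[]
subsets-unique (suc n) = Unique.++⁺
  (Unique.map⁺ ∷-injectiveʳ (subsets-unique n)) (Unique.map⁺ ∷-injectiveʳ (subsets-unique n)) disjoint
  where
  disjoint : ∀ {S} → ¬ (S List.∈ map (inside Vec.∷_) (subsets n) × S List.∈ map (outside Vec.∷_) (subsets n))
  disjoint (p , q) with ∈-map⁻ _ p | ∈-map⁻ _ q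
  ... | _ , _ , refl | _ , _ , ()

bit : Bool → ℕ
bit b = if b then 1 else 0

∣∣-∑Fin : (S : Subset n) → ∣ S ∣ ≡ ∑Fin (bit ∘ lookup S)
∣∣-∑Fin Vec.[]              = refl
∣∣-∑Fin (inside  Vec.∷ S)   = cong suc (∣∣-∑Fin S)
∣∣-∑Fin (outside Vec.∷ S)   = ∣∣-∑Fin S

module _ (π : Permutation m n) where

  -- A relation in place of an equation with `image S`: complements, intersections and
  -- neighbourhoods are then transported pointwise, and the roles of S and T can be exchanged by
  -- `matches-flip`.
  record Matches (S : Subset m) (T : Subset n) : Set where
    constructor matching
    field lookup-≡ : ∀ u → lookup S u ≡ lookup T (π ⟨$⟩ʳ u)

  open Matches public

  image : Subset m → Subset n
  image S = Vec.tabulate λ v → lookup S (π ⟨$⟩ˡ v)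

  image-matches : ∀ S → Matches S (image S)
  image-matches S = matching λ u → sym (trans (lookup∘tabulate _ (π ⟨$⟩ʳ u)) (cong (lookup S) (inverseˡ π)))

  matches-∣∣ : ∀ {S T} → Matches S T → ∣ S ∣ ≡ ∣ T ∣
  matches-∣∣ {S} {T} S~T = begin
    ∣ S ∣                                     ≡⟨ ∣∣-∑Fin S ⟩
    ∑Fin (bit ∘ lookup S)                     ≡⟨ sum-cong-≗ +-0-commutativeMonoid (cong bit ∘ lookup-≡ S~T) ⟩
    ∑Fin (bit ∘ lookup T ∘ (π ⟨$⟩ʳ_))         ≡⟨ sum-permute +-0-commutativeMonoid (bit ∘ lookup T) π ⟨
    ∑Fin (bit ∘ lookup T)                     ≡⟨ ∣∣-∑Fin T ⟨
    ∣ T ∣                                     ∎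
    where open ≡-Reasoning

  matches-∁ : ∀ {S T} → Matches S T → Matches (∁ S) (∁ T)
  matches-∁ {S} {T} S~T = matching λ u →
    trans (lookup-map u not S) (trans (cong not (lookup-≡ S~T u)) (sym (lookup-map (π ⟨$⟩ʳ u) not T)))

  matches-∩ : ∀ {S S′ T T′} → Matches S T → Matches S′ T′ → Matches (S ∩ S′) (T ∩ T′)
  matches-∩ {S} {S′} {T} {T′} S~T S′~T′ = matching λ u → trans (lookup-zipWith _∧_ u S S′)
    (trans (cong₂ _∧_ (lookup-≡ S~T u) (lookup-≡ S′~T′ u)) (sym (lookup-zipWith _∧_ (π ⟨$⟩ʳ u) T T′)))

  matches-∈ : ∀ {S T u} → Matches S T → u ∈ S → π ⟨$⟩ʳ u ∈ T
  matches-∈ {T = T} {u} S~T u∈S = lookup⇒[]= _ T (trans (sym (lookup-≡ S~T u)) ([]=⇒lookup u∈S))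

  matches-nonempty : ∀ {S T} → Matches S T → Nonempty S → Nonempty T
  matches-nonempty S~T (u , u∈S) = π ⟨$⟩ʳ u , matches-∈ S~T u∈S

  image-injective : ∀ {S S′} → image S ≡ image S′ → S ≡ S′
  image-injective {S} {S′} eq = lookup-ext λ u →
    trans (lookup-≡ (image-matches S) u) (trans (cong (λ T → lookup T (π ⟨$⟩ʳ u)) eq) (sym (lookup-≡ (image-matches S′) u)))

  image-surjective : ∀ T → ∃ λ S → T ≡ image S
  image-surjective T = S , lookup-ext λ v → sym (begin
    lookup (image S) v                ≡⟨ lookup∘tabulate _ v ⟩
    lookup S (π ⟨$⟩ˡ v) ≡⟨ lookup∘tabulate _ (π ⟨$⟩ˡ v) ⟩
    lookup T (π ⟨$⟩ʳ (π ⟨$⟩ˡ v))       ≡⟨ cong (lookup T) (inverseʳ π) ⟩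
    lookup T v                        ∎)
    where
    open ≡-Reasoning
    S = Vec.tabulate λ u → lookup T (π ⟨$⟩ʳ u)

  -- Both lists are free of repetitions and contain every subset, so they agree up to order.
  map-image-subsets : map image (subsets m) ↭ subsets n
  map-image-subsets = ∼bag⇒↭ (unique∧set⇒bag
    (Unique.map⁺ image-injective (subsets-unique m)) (subsets-unique n)
    (mk⇔ (λ _ → ∈-subsets _) (λ _ → preimage _)))
    where
    preimage : ∀ T → T List.∈ map image (subsets m)
    preimage T with image-surjective T
    ... | S , refl = ∈-map⁺ image (∈-subsets S)

  ∑-subsets-image : (F : Subset n → ℕ) → ∑ (subsets m) (F ∘ image) ≡ ∑ (subsets n) F
  ∑-subsets-image F = trans (sym (∑-map image (subsets m))) (sum-↭ (↭.map⁺ F map-image-subsets))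

matches-flip : (π : Permutation m n) {S : Subset m} {T : Subset n} → Matches π S T → Matches (flip π) T S
matches-flip π {S} {T} S~T = matching λ v →
  sym (trans (lookup-≡ S~T (π ⟨$⟩ˡ v)) (cong (lookup T) (inverseʳ π)))

-- Minima and the exponent `f-y`.

minimum-∈ : ∀ {k} ks → k List.∈ ks → minimum ks List.∈ ks
minimum-∈ (k ∷ ks) _ with argmin-sel id k ks
... | inj₁ eq  = here eq
... | inj₂ min∈ks = there min∈ks

minimum-≤ : ∀ {k} ks → k List.∈ ks → minimum ks ≤ k
minimum-≤ (k ∷ ks) (here refl) = min≤v⁺ k ks (inj₁ ≤-refl)
minimum-≤ (k ∷ ks) (there l∈ks) = min≤v⁺ k ks (inj₂ (Any.map (≤-reflexive ∘ sym) l∈ks))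

margin : Graph n → Subset n → Fin n → ℕ
margin {n} G S u = (δ G S u + n) ∸ δ G (∁ S) u

module _ (G : Graph n) (S : Subset n) where

  f-y-attained : Nonempty S → ∃ λ u → u ∈ S × f-y G S ≡ margin G S u
  f-y-attained (u , u∈S) with
    ∈-map⁻ (margin G S) (minimum-∈ _ (∈-map⁺ (margin G S) (∈-filter⁺ (_∈? S) (∈-allFin u) u∈S)))
  ... | v , v∈ , eq = v , proj₂ (∈-filter⁻ (_∈? S) {xs = allFin n} v∈) , eq

  f-y-≤-margin : ∀ {u} → u ∈ S → f-y G S ≤ margin G S u
  f-y-≤-margin {u} u∈S = minimum-≤ _ (∈-map⁺ (margin G S) (∈-filter⁺ (_∈? S) (∈-allFin u) u∈S))

  -- An attained lower bound is the minimum. Computing `f-y` thus reduces to exhibiting one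
  -- minimising vertex and bounding the margins of the others, without looking at the filtered list.
  f-y-unique : ∀ {k u} → u ∈ S → margin G S u ≡ k → (∀ {v} → v ∈ S → k ≤ margin G S v) → f-y G S ≡ k
  f-y-unique {k} {u} u∈S eq lower = ≤-antisym (subst (f-y G S ≤_) eq (f-y-≤-margin u∈S)) k≤f-y
    where
    k≤f-y : k ≤ f-y G S
    k≤f-y with f-y-attained (u , u∈S)
    ... | v , v∈S , eq′ = subst (k ≤_) (sym eq′) (lower v∈S)

deg : Graph n → Fin n → ℕ
deg G u = ∣ neighbourhood G u ∣

-- Moves the filter of `da` into the summand. The sum then runs over all subsets, which can be split
-- on membership of the first vertex and permuted by a relabelling.
weight : (ℕ → ℕ → ℕ) → Graph n → Subset n → ℕ
weight φ G S = if does (nonempty? S ×-dec connected? G S) then φ ∣ S ∣ (f-y G S) else 0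

⟦⟧-da : (G : Graph n) {φ : ℕ → ℕ → ℕ} → ⟦ da G ⟧ φ ≡ ∑ (subsets n) (weight φ G)
⟦⟧-da {n} G {φ} = begin
  ⟦ da G ⟧ φ                                          ≡⟨ ⟦⟧-∑ₚ (connectedSubsets G) _ ⟩
  ∑ (connectedSubsets G) (λ S → ⟦ x^ ∣ S ∣ y^ f-y G S ⟧ φ) ≡⟨ ∑-cong (connectedSubsets G) (λ S → trans (⟦⟧-monomial 1 ∣ S ∣ (f-y G S) {φ}) (*-identityˡ _)) ⟩
  ∑ (connectedSubsets G) (λ S → φ ∣ S ∣ (f-y G S))    ≡⟨ ∑-filter _ (subsets n) ⟩
  ∑ (subsets n) (weight φ G)                          ∎
  where open ≡-Reasoning

module _ (φ : ℕ → ℕ → ℕ) (G : Graph n) (S : Subset n) where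

  weight-connected : Nonempty S → Connected G S → weight φ G S ≡ φ ∣ S ∣ (f-y G S)
  weight-connected ne conn =
    cong (if_then φ ∣ S ∣ (f-y G S) else 0) (dec-true (nonempty? S ×-dec connected? G S) (ne , conn))

  weight-otherwise : ¬ (Nonempty S × Connected G S) → weight φ G S ≡ 0
  weight-otherwise ¬p =
    cong (if_then φ ∣ S ∣ (f-y G S) else 0) (dec-false (nonempty? S ×-dec connected? G S) ¬p)

-- Invariance of `da` under isomorphism.

≅-sym : {G : Graph m} {H : Graph n} → G ≅ H → H ≅ G
≅-sym {H = H} i = record
  { bijection = flip π
  ; adj-iff   = λ u v → mk⇔
      (λ p → from (adj-iff (π ⟨$⟩ˡ u) (π ⟨$⟩ˡ v)) (subst₂ (Adj H) (sym (inverseʳ π)) (sym (inverseʳ π)) p))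
      (λ p → subst₂ (Adj H) (inverseʳ π) (inverseʳ π) (to (adj-iff (π ⟨$⟩ˡ u) (π ⟨$⟩ˡ v)) p))
  }
  where
  open _≅_ i renaming (bijection to π)
  open Equivalence

connected-≅ : {G : Graph m} {H : Graph n} (i : G ≅ H) → let π = _≅_.bijection i in
  ∀ {S T} → Matches π S T → Connected G S → Connected H T
connected-≅ {G = G} {H} i {S} {T} S~T conn u v u∈T v∈T =
  subst₂ (Star (InducedAdj H T)) (inverseʳ π) (inverseʳ π)
    (gmap (π ⟨$⟩ʳ_) (λ (u∈S , v∈S , p) → matches-∈ π S~T u∈S , matches-∈ π S~T v∈S , Equivalence.to (adj-iff _ _) p)
      (conn (π ⟨$⟩ˡ u) (π ⟨$⟩ˡ v) (matches-∈ (flip π) T~S u∈T) (matches-∈ (flip π) T~S v∈T)))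
  where
  open _≅_ i renaming (bijection to π)
  T~S = matches-flip π S~T

module _ {G : Graph m} {H : Graph n} (i : G ≅ H) where
  open _≅_ i renaming (bijection to π)

  neighbourhood-≅ : ∀ u → Matches π (neighbourhood G u) (neighbourhood H (π ⟨$⟩ʳ u))
  neighbourhood-≅ u = matching λ v → trans (lookup∘tabulate _ v)
    (trans (does-⇔ (adj-iff u v) (adj? G u v) (adj? H (π ⟨$⟩ʳ u) (π ⟨$⟩ʳ v)))
      (sym (lookup∘tabulate _ (π ⟨$⟩ʳ v))))

  deg-≅ : ∀ u → deg G u ≡ deg H (π ⟨$⟩ʳ u)
  deg-≅ u = matches-∣∣ π (neighbourhood-≅ u)

  δ-≅ : ∀ {S T} → Matches π S T → ∀ u → δ G S u ≡ δ H T (π ⟨$⟩ʳ u)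
  δ-≅ S~T u = matches-∣∣ π (matches-∩ π S~T (neighbourhood-≅ u))

  order-≅ : m ≡ n
  order-≅ = Perm.↔⇒≡ π

  margin-≅ : ∀ {S T} → Matches π S T → ∀ u → margin G S u ≡ margin H T (π ⟨$⟩ʳ u)
  margin-≅ S~T u = cong₂ _∸_ (cong₂ _+_ (δ-≅ S~T u) order-≅) (δ-≅ (matches-∁ π S~T) u)

  f-y-≅ : ∀ {S T} → Matches π S T → Nonempty S → f-y G S ≡ f-y H T
  f-y-≅ {S} {T} S~T ne with f-y-attained G S ne
  ... | u , u∈S , eq = sym (f-y-unique H T (matches-∈ π S~T u∈S) (sym (trans eq (margin-≅ S~T u))) lower)
    where
    lower : ∀ {v} → v ∈ T → f-y G S ≤ margin H T v
    lower {v} v∈T = subst (f-y G S ≤_)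
      (trans (margin-≅ S~T (π ⟨$⟩ˡ v)) (cong (margin H T) (inverseʳ π)))
      (f-y-≤-margin G S (matches-∈ (flip π) (matches-flip π S~T) v∈T))

module _ {G : Graph m} {H : Graph n} (i : G ≅ H) where
  open _≅_ i renaming (bijection to π)

  weight-≅ : ∀ {φ S T} → Matches π S T → weight φ G S ≡ weight φ H T
  weight-≅ {φ} {S} {T} S~T with nonempty? S ×-dec connected? G S
  ... | yes (ne , conn) = trans (weight-connected φ G S ne conn) (trans
    (cong₂ φ (matches-∣∣ π S~T) (f-y-≅ i S~T ne))
    (sym (weight-connected φ H T (matches-nonempty π S~T ne) (connected-≅ i S~T conn))))
  -- A set that does not count must stay so after transport, hence the inverse isomorphism.
  ... | no ¬p = trans (weight-otherwise φ G S ¬p) (sym (weight-otherwise φ H T λ (ne , conn) →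
    ¬p (matches-nonempty (flip π) (matches-flip π S~T) ne , connected-≅ (≅-sym i) (matches-flip π S~T) conn)))

  ⟦⟧-da-≅ : ∀ φ → ⟦ da G ⟧ φ ≡ ⟦ da H ⟧ φ
  ⟦⟧-da-≅ φ = begin
    ⟦ da G ⟧ φ                            ≡⟨ ⟦⟧-da G ⟩
    ∑ (subsets m) (weight φ G)            ≡⟨ ∑-cong (subsets m) (λ S → weight-≅ {φ} (image-matches π S)) ⟩
    ∑ (subsets m) (weight φ H ∘ image π)  ≡⟨ ∑-subsets-image π (weight φ H) ⟩
    ∑ (subsets n) (weight φ H)            ≡⟨ ⟦⟧-da H ⟨
    ⟦ da H ⟧ φ                            ∎
    where open ≡-Reasoning

-- Cardinalities, connectedness and margins.

∣∣-split : (S T : Subset n) → ∣ S ∩ T ∣ + ∣ ∁ S ∩ T ∣ ≡ ∣ T ∣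
∣∣-split Vec.[] Vec.[] = refl
∣∣-split (inside  ∷ S) (inside  ∷ T) = cong suc (∣∣-split S T)
∣∣-split (inside  ∷ S) (outside ∷ T) = ∣∣-split S T
∣∣-split (outside ∷ S) (inside  ∷ T) = trans (+-suc _ _) (cong suc (∣∣-split S T))
∣∣-split (outside ∷ S) (outside ∷ T) = ∣∣-split S T

∣∣-splitʳ : (S T : Subset n) → ∣ S ∩ T ∣ + ∣ S ∩ ∁ T ∣ ≡ ∣ S ∣
∣∣-splitʳ S T = trans (cong₂ (λ p q → ∣ p ∣ + ∣ q ∣) (∩-comm S T) (∩-comm S (∁ T))) (∣∣-split T S)

∣∣-∁ : (S : Subset n) → ∣ S ∣ + ∣ ∁ S ∣ ≡ n
∣∣-∁ {n} S = trans (cong₂ (λ p q → ∣ p ∣ + ∣ q ∣) (sym (∩-identityˡ S)) (sym (∩-identityˡ (∁ S))))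
  (trans (∣∣-splitʳ ⊤ S) (∣⊤∣≡n n))

∣⁅u⁆∩S∣≡1 : {u : Fin n} {S : Subset n} → u ∈ S → ∣ ⁅ u ⁆ ∩ S ∣ ≡ 1
∣⁅u⁆∩S∣≡1 {suc n} {S = _ ∷ S} here = cong suc (trans (cong ∣_∣ (∩-zeroˡ S)) (∣⊥∣≡0 n))
∣⁅u⁆∩S∣≡1 (there u∈S) = ∣⁅u⁆∩S∣≡1 u∈S

∣S∩∁⁅u⁆∣ : {u : Fin n} {S : Subset n} → u ∈ S → suc ∣ S ∩ ∁ ⁅ u ⁆ ∣ ≡ ∣ S ∣
∣S∩∁⁅u⁆∣ {u = u} {S} u∈S = begin
  1 + ∣ S ∩ ∁ ⁅ u ⁆ ∣               ≡⟨ cong (_+ ∣ S ∩ ∁ ⁅ u ⁆ ∣) (trans (cong ∣_∣ (∩-comm S ⁅ u ⁆)) (∣⁅u⁆∩S∣≡1 u∈S)) ⟨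
  ∣ S ∩ ⁅ u ⁆ ∣ + ∣ S ∩ ∁ ⁅ u ⁆ ∣   ≡⟨ ∣∣-splitʳ S ⁅ u ⁆ ⟩
  ∣ S ∣                             ∎
  where open ≡-Reasoning

∣∁⁅u⁆∣ : (u : Fin n) → suc ∣ ∁ ⁅ u ⁆ ∣ ≡ n
∣∁⁅u⁆∣ {n} u = trans (cong (suc ∘ ∣_∣) (sym (∩-identityˡ (∁ ⁅ u ⁆)))) (trans (∣S∩∁⁅u⁆∣ {u = u} {⊤} ∈⊤) (∣⊤∣≡n n))

lookup-⁅⁆ : (u v : Fin n) → lookup ⁅ u ⁆ v ≡ does (u Fin.≟ v)
lookup-⁅⁆ zero    zero    = refl
lookup-⁅⁆ zero    (suc v) = lookup-replicate v outside
lookup-⁅⁆ (suc u) zero    = refl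
lookup-⁅⁆ (suc u) (suc v) = lookup-⁅⁆ u v

does-∈? : (u : Fin n) (S : Subset n) → does (u ∈? S) ≡ lookup S u
does-∈? zero    (inside  ∷ S) = refl
does-∈? zero    (outside ∷ S) = refl
does-∈? (suc u) (_ ∷ S)       = does-∈? u S

∈-∁ : (S : Subset n) (u : Fin n) → u ∈ S ⊎ u ∈ ∁ S
∈-∁ S u with u ∈? S
... | yes u∈S = inj₁ u∈S
... | no  u∉S = inj₂ (x∉p⇒x∈∁p u∉S)

∣S∣≡0⇒∉ : {S : Subset n} {u : Fin n} → ∣ S ∣ ≡ 0 → u ∉ S
∣S∣≡0⇒∉ {S = S} {u} ∣S∣≡0 u∈S with trans (∣S∩∁⁅u⁆∣ {S = S} u∈S) ∣S∣≡0
... | ()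

∣S∣≡suc⇒nonempty : ∀ {k} (S : Subset n) → ∣ S ∣ ≡ suc k → Nonempty S
∣S∣≡suc⇒nonempty {n} S ∣S∣≡suc with nonempty? S
... | yes ne = ne
... | no  ¬ne with trans (sym ∣S∣≡suc) (trans (cong ∣_∣ (Empty-unique {p = S} ¬ne)) (∣⊥∣≡0 n))
...   | ()

-- Any two vertices are joined through w. All the connected sets whose weights are computed below
-- have such a vertex, so longer walks never have to be built.
connected-hub : (G : Graph n) (S : Subset n) {w : Fin n} → w ∈ S →
                (∀ {u} → u ∈ S → u ≡ w ⊎ Adj G u w) → Connected G S
connected-hub G S {w} w∈S hub u v u∈S v∈S = toHub (hub u∈S) ◅◅ fromHub (hub v∈S)
  where
  toHub : u ≡ w ⊎ Adj G u w → Star (InducedAdj G S) u w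
  toHub (inj₁ refl) = ε
  toHub (inj₂ p)    = (u∈S , w∈S , p) ◅ ε

  fromHub : v ≡ w ⊎ Adj G v w → Star (InducedAdj G S) w v
  fromHub (inj₁ refl) = ε
  fromHub (inj₂ p)    = (w∈S , v∈S , adj-sym G p) ◅ ε

-- Comparing with deg avoids the truncated subtraction.
margin-≡ : (G : Graph n) (S : Subset n) (u : Fin n) {k : ℕ} →
           deg G u + k ≡ δ G S u + (δ G S u + n) → margin G S u ≡ k
margin-≡ {n} G S u {k} eq = begin
  (d + n) ∸ e              ≡⟨ [m+n]∸[m+o]≡n∸o d (d + n) e ⟨
  (d + (d + n)) ∸ (d + e)  ≡⟨ cong₂ _∸_ eq (sym (∣∣-split S (neighbourhood G u))) ⟨
  (deg G u + k) ∸ deg G u  ≡⟨ m+n∸m≡n (deg G u) k ⟩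
  k                        ∎
  where
  open ≡-Reasoning
  d = δ G S u
  e = δ G (∁ S) u

-- The vertex w witnessing connectedness and the vertex u attaining the minimum are kept apart: for
-- a set in H with v₀ and vertices of both R and S, w is taken in R, while u is v₀ or lies in S.
weight-≡ : (φ : ℕ → ℕ → ℕ) (G : Graph n) (S : Subset n) {w u : Fin n} {c k : ℕ} →
           w ∈ S → (∀ {v} → v ∈ S → v ≡ w ⊎ Adj G v w) →
           u ∈ S → margin G S u ≡ k → (∀ {v} → v ∈ S → k ≤ margin G S v) →
           ∣ S ∣ ≡ c → weight φ G S ≡ φ c k
weight-≡ φ G S w∈S hub u∈S eq lower refl =
  trans (weight-connected φ G S (_ , w∈S) (connected-hub G S w∈S hub))
        (cong (φ ∣ S ∣) (f-y-unique G S u∈S eq lower))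

-- The polynomial of a complete graph.

neighbourhood-complete : (u : Fin n) → neighbourhood (complete n) u ≡ ∁ ⁅ u ⁆
neighbourhood-complete u = lookup-ext λ v → trans (lookup∘tabulate _ v)
  (trans (cong not (sym (lookup-⁅⁆ u v))) (sym (lookup-map v not ⁅ u ⁆)))

adj-complete : (u v : Fin n) → v ≡ u ⊎ Adj (complete n) v u
adj-complete u v with v Fin.≟ u
... | yes v≡u = inj₁ v≡u
... | no  v≢u = inj₂ v≢u

-- With c = ∣S∣, the vertex u has c - 1 neighbours inside and n - c outside, and (c - 1) - (n - c) +
-- n = 2c - 1.
margin-complete : (S : Subset n) {u : Fin n} → u ∈ S → margin (complete n) S u ≡ 2 * ∣ S ∣ ∸ 1
margin-complete {n} S {u} u∈S = margin-≡ (complete n) S u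
  (arith (trans (cong (λ N → suc ∣ S ∩ N ∣) (neighbourhood-complete u)) (∣S∩∁⁅u⁆∣ u∈S))
         (trans (cong (suc ∘ ∣_∣) (neighbourhood-complete u)) (∣∁⁅u⁆∣ u)))
  where
  -- Replacing c by `suc d` lets `2 * c ∸ 1` reduce to a term without `∸`, which the ring solver
  -- accepts.
  arith : ∀ {d c D n} → suc d ≡ c → suc D ≡ n → D + (2 * c ∸ 1) ≡ d + (d + n)
  arith {d} {_} {D} refl refl = ring d D
    where
    ring : ∀ d D → D + (d + suc (d + 0)) ≡ d + (d + suc D)
    ring = solve-∀

-- The contribution of a non-empty k-set in a complete graph. The same exponent recurs in H for the
-- sets that meet R and avoid v₀.
cliqueTerm : (ℕ → ℕ → ℕ) → ℕ → ℕ
cliqueTerm φ k = φ k (2 * k ∸ 1)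

weight-complete : (φ : ℕ → ℕ → ℕ) (S : Subset n) → weight φ (complete n) S ≡ onPositive (cliqueTerm φ) ∣ S ∣
weight-complete {n} φ S = go ∣ S ∣ refl
  where
  go : ∀ c → ∣ S ∣ ≡ c → weight φ (complete n) S ≡ onPositive (cliqueTerm φ) c
  go zero    ∣S∣≡0 = weight-otherwise φ (complete n) S λ ((_ , u∈S) , _) → ∣S∣≡0⇒∉ {S = S} ∣S∣≡0 u∈S
  go (suc c) ∣S∣≡c with ∣S∣≡suc⇒nonempty S ∣S∣≡c
  ... | u , u∈S = weight-≡ φ (complete n) S u∈S (λ _ → adj-complete u _) u∈S (margin-at u∈S)
    (λ v∈S → ≤-reflexive (sym (margin-at v∈S))) ∣S∣≡c
    where
    margin-at : ∀ {v} → v ∈ S → margin (complete n) S v ≡ 2 * suc c ∸ 1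
    margin-at v∈S = trans (margin-complete S v∈S) (cong (λ c → 2 * c ∸ 1) ∣S∣≡c)

⟦⟧-da-complete : ∀ r {φ} → ⟦ da (complete r) ⟧ φ ≡ sizeSum r (onPositive (cliqueTerm φ))
⟦⟧-da-complete r {φ} = begin
  ⟦ da (complete r) ⟧ φ                                   ≡⟨ ⟦⟧-da (complete r) ⟩
  ∑ (subsets r) (weight φ (complete r))                   ≡⟨ ∑-cong (subsets r) (weight-complete φ) ⟩
  ∑ (subsets r) (λ S → onPositive (cliqueTerm φ) ∣ S ∣)     ≡⟨ ∑-subsets-size r _ ⟩
  sizeSum r (onPositive (cliqueTerm φ))                     ∎
  where open ≡-Reasoning

-- Margins and weights in H.

neighbourhood-new : (J : Subset n) → neighbourhood (addVertex (complete n) J) zero ≡ outside ∷ J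
neighbourhood-new J = cong (outside ∷_) (lookup-ext λ v → trans (lookup∘tabulate _ v) (does-∈? v J))

neighbourhood-old : (J : Subset n) (u : Fin n) →
                    neighbourhood (addVertex (complete n) J) (suc u) ≡ lookup J u ∷ ∁ ⁅ u ⁆
neighbourhood-old J u = cong₂ _∷_ (does-∈? u J) (neighbourhood-complete u)

module _ {n : ℕ} (J : Subset n) where

  private
    H : Graph (suc n)
    H = addVertex (complete n) J
    r = ∣ J ∣
    s = ∣ ∁ J ∣

  module _ (X : Subset n) where

    private
      old-J : ∀ {u} → u ∈ J → neighbourhood H (suc u) ≡ inside ∷ ∁ ⁅ u ⁆
      old-J {u} u∈J = trans (neighbourhood-old J u) (cong (_∷ ∁ ⁅ u ⁆) ([]=⇒lookup u∈J))

      old-∁J : ∀ {u} → u ∈ ∁ J → neighbourhood H (suc u) ≡ outside ∷ ∁ ⁅ u ⁆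
      old-∁J {u} u∈∁J = trans (neighbourhood-old J u) (cong (_∷ ∁ ⁅ u ⁆) lookup≡outside)
        where
        lookup≡outside : lookup J u ≡ outside
        lookup≡outside with lookup J u in eq
        ... | outside = refl
        ... | inside  = contradiction (lookup⇒[]= u J eq) (x∈∁p⇒x∉p u∈∁J)

    -- Compared with `complete n`, the larger order n + 1 raises every margin by 1. If u lies in J,
    -- then v₀ lowers it by 1 as a neighbour outside the set and raises it by 1 as a neighbour
    -- inside; if u lies outside J, then v₀ has no effect. Starting from 2c - 1 with c = ∣X∣, this
    -- gives the values of this lemma and the next three.
    margin-without-J : ∀ {u} → u ∈ X → u ∈ J → margin H (outside ∷ X) (suc u) ≡ 2 * ∣ X ∣ ∸ 1
    margin-without-J {u} u∈X u∈J = margin-≡ H (outside ∷ X) (suc u)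
      (arith (trans (cong (λ N → suc ∣ (outside ∷ X) ∩ N ∣) (old-J u∈J)) (∣S∩∁⁅u⁆∣ u∈X))
             (trans (cong ∣_∣ (old-J u∈J)) (∣∁⁅u⁆∣ u)))
      where
      arith : ∀ {d c D n} → suc d ≡ c → D ≡ n → D + (2 * c ∸ 1) ≡ d + (d + suc n)
      arith {d} {_} {D} refl refl = ring d D
        where
        ring : ∀ d D → D + (d + suc (d + 0)) ≡ d + (d + suc D)
        ring = solve-∀

    margin-without-∁J : ∀ {u} → u ∈ X → u ∈ ∁ J → margin H (outside ∷ X) (suc u) ≡ 2 * ∣ X ∣
    margin-without-∁J {u} u∈X u∈∁J = margin-≡ H (outside ∷ X) (suc u)
      (arith (trans (cong (λ N → suc ∣ (outside ∷ X) ∩ N ∣) (old-∁J u∈∁J)) (∣S∩∁⁅u⁆∣ u∈X))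
             (trans (cong (suc ∘ ∣_∣) (old-∁J u∈∁J)) (∣∁⁅u⁆∣ u)))
      where
      arith : ∀ {d c D n} → suc d ≡ c → suc D ≡ n → D + 2 * c ≡ d + (d + suc n)
      arith {d} {_} {D} refl refl = ring d D
        where
        ring : ∀ d D → D + 2 * suc d ≡ d + (d + suc (suc D))
        ring = solve-∀

    margin-with-J : ∀ {u} → u ∈ X → u ∈ J → margin H (inside ∷ X) (suc u) ≡ suc (2 * ∣ X ∣)
    margin-with-J {u} u∈X u∈J = margin-≡ H (inside ∷ X) (suc u)
      (arith (trans (cong (λ N → ∣ (inside ∷ X) ∩ N ∣) (old-J u∈J)) (∣S∩∁⁅u⁆∣ u∈X))
             (trans (cong ∣_∣ (old-J u∈J)) (∣∁⁅u⁆∣ u)))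
      where
      arith : ∀ {d c D n} → d ≡ c → D ≡ n → D + suc (2 * c) ≡ d + (d + suc n)
      arith {d} {_} {D} refl refl = ring d D
        where
        ring : ∀ d D → D + suc (2 * d) ≡ d + (d + suc D)
        ring = solve-∀

    margin-with-∁J : ∀ {u} → u ∈ X → u ∈ ∁ J → margin H (inside ∷ X) (suc u) ≡ 2 * ∣ X ∣
    margin-with-∁J {u} u∈X u∈∁J = margin-≡ H (inside ∷ X) (suc u)
      (arith (trans (cong (λ N → suc ∣ (inside ∷ X) ∩ N ∣) (old-∁J u∈∁J)) (∣S∩∁⁅u⁆∣ u∈X))
             (trans (cong (suc ∘ ∣_∣) (old-∁J u∈∁J)) (∣∁⁅u⁆∣ u)))
      where
      arith : ∀ {d c D n} → suc d ≡ c → suc D ≡ n → D + 2 * c ≡ d + (d + suc n)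
      arith {d} {_} {D} refl refl = ring d D
        where
        ring : ∀ d D → D + 2 * suc d ≡ d + (d + suc (suc D))
        ring = solve-∀

    -- With a = ∣X ∩ J∣, the vertex v₀ has a neighbours inside and r - a outside, and a - (r - a) +
    -- (n + 1) = 2a + s + 1 because n = r + s.
    margin-new : margin H (inside ∷ X) zero ≡ 2 * ∣ X ∩ J ∣ + (s + 1)
    margin-new = margin-≡ H (inside ∷ X) zero
      (arith (cong (λ N → ∣ (inside ∷ X) ∩ N ∣) (neighbourhood-new J))
             (cong ∣_∣ (neighbourhood-new J)) (∣∣-∁ J))
      where
      arith : ∀ {d a D r s n} → d ≡ a → D ≡ r → r + s ≡ n → D + (2 * a + (s + 1)) ≡ d + (d + suc n)
      arith {d} {_} {D} {_} {s} refl refl refl = ring d D s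
        where
        ring : ∀ d D s → D + (2 * d + (s + 1)) ≡ d + (d + suc (D + s))
        ring = solve-∀

  -- The weights of A ∪ B and of {v₀} ∪ A ∪ B for A ⊆ R, B ⊆ S with ∣ A ∣ = a and ∣ B ∣ = b.
  withoutNew withNew : (ℕ → ℕ → ℕ) → ℕ → ℕ → ℕ

  withoutNew φ zero    zero    = 0
  withoutNew φ zero    (suc b) = φ (suc b) (2 * suc b)
  withoutNew φ (suc a) b       = cliqueTerm φ (suc a + b)

  withNew φ zero    zero    = φ 1 (n + 1 ∸ r)
  withNew φ zero    (suc b) = 0
  withNew φ (suc a) zero    = φ (suc (suc a)) (suc (2 * suc a))
  withNew φ (suc a) (suc b) = φ (suc (suc a + suc b)) (2 * suc a + ((2 * suc b) ⊓ (s + 1)))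

  module _ (φ : ℕ → ℕ → ℕ) (X : Subset n) where

    private
      size : ∀ {a b} → ∣ X ∩ J ∣ ≡ a → ∣ X ∩ ∁ J ∣ ≡ b → ∣ X ∣ ≡ a + b
      size refl refl = sym (∣∣-splitʳ X J)

      in-∁J : ∣ X ∩ J ∣ ≡ 0 → ∀ {u} → u ∈ X → u ∈ ∁ J
      in-∁J ∣A∣≡0 {u} u∈X with ∈-∁ J u
      ... | inj₁ u∈J  = contradiction (x∈p∩q⁺ (u∈X , u∈J)) (∣S∣≡0⇒∉ ∣A∣≡0)
      ... | inj₂ u∈∁J = u∈∁J

      in-J : ∣ X ∩ ∁ J ∣ ≡ 0 → ∀ {u} → u ∈ X → u ∈ J
      in-J ∣B∣≡0 {u} u∈X with ∈-∁ J u
      ... | inj₁ u∈J  = u∈J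
      ... | inj₂ u∈∁J = contradiction (x∈p∩q⁺ (u∈X , u∈∁J)) (∣S∣≡0⇒∉ ∣B∣≡0)

      hub-old : ∀ {w} → w ∈ X → ∀ {v} → v ∈ outside ∷ X → v ≡ suc w ⊎ Adj H v (suc w)
      hub-old {w} w∈X {suc v} _ with adj-complete w v
      ... | inj₁ v≡w = inj₁ (cong suc v≡w)
      ... | inj₂ v~w = inj₂ (old v~w)

      hub-J : ∀ {w} → w ∈ J → ∀ {v} → v ∈ inside ∷ X → v ≡ suc w ⊎ Adj H v (suc w)
      hub-J w∈J {zero} _ = inj₂ (new-l w∈J)
      hub-J {w} w∈J {suc v} _ with adj-complete w v
      ... | inj₁ v≡w = inj₁ (cong suc v≡w)
      ... | inj₂ v~w = inj₂ (old v~w)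

    -- Without v₀, the margin of a vertex of R is one less than that of a vertex of S, so the
    -- minimum is attained in R as soon as the set meets R.
    weight-withoutNew : weight φ H (outside ∷ X) ≡ withoutNew φ ∣ X ∩ J ∣ ∣ X ∩ ∁ J ∣
    weight-withoutNew = go _ _ refl refl
      where
      go : ∀ a b → ∣ X ∩ J ∣ ≡ a → ∣ X ∩ ∁ J ∣ ≡ b → weight φ H (outside ∷ X) ≡ withoutNew φ a b
      go zero zero ∣A∣ ∣B∣ = weight-otherwise φ H (outside ∷ X)
        λ { ((suc u , there u∈X) , _) → ∣S∣≡0⇒∉ (size ∣A∣ ∣B∣) u∈X }
      go zero (suc b) ∣A∣ ∣B∣ with ∣S∣≡suc⇒nonempty X (size ∣A∣ ∣B∣)
      ... | w , w∈X = weight-≡ φ H (outside ∷ X) (there w∈X) (hub-old w∈X) (there w∈X) (margin-at w∈X)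
        (λ { {suc v} (there v∈X) → ≤-reflexive (sym (margin-at v∈X)) }) (size ∣A∣ ∣B∣)
        where
        margin-at : ∀ {v} → v ∈ X → margin H (outside ∷ X) (suc v) ≡ 2 * suc b
        margin-at v∈X = trans (margin-without-∁J X v∈X (in-∁J ∣A∣ v∈X)) (cong (2 *_) (size ∣A∣ ∣B∣))
      go (suc a) b ∣A∣ ∣B∣ with ∣S∣≡suc⇒nonempty (X ∩ J) ∣A∣
      ... | w , w∈A = weight-≡ φ H (outside ∷ X) (there w∈X) (hub-old w∈X) (there w∈X) (at-J w∈X w∈J)
        lower (size ∣A∣ ∣B∣)
        where
        w∈X = proj₁ (x∈p∩q⁻ X J w∈A)
        w∈J = proj₂ (x∈p∩q⁻ X J w∈A)
        at-J : ∀ {v} → v ∈ X → v ∈ J → margin H (outside ∷ X) (suc v) ≡ 2 * (suc a + b) ∸ 1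
        at-J v∈X v∈J = trans (margin-without-J X v∈X v∈J) (cong (λ c → 2 * c ∸ 1) (size ∣A∣ ∣B∣))
        lower : ∀ {v} → v ∈ outside ∷ X → 2 * (suc a + b) ∸ 1 ≤ margin H (outside ∷ X) v
        lower {suc v} (there v∈X) with ∈-∁ J v
        ... | inj₁ v∈J  = ≤-reflexive (sym (at-J v∈X v∈J))
        ... | inj₂ v∈∁J = ≤-trans (m∸n≤m _ 1)
          (≤-reflexive (sym (trans (margin-without-∁J X v∈X v∈∁J) (cong (2 *_) (size ∣A∣ ∣B∣)))))

    -- With v₀ present the margins are 2a + s + 1 at v₀, 2(a + b) in S and 2(a + b) + 1 in R. If a
    -- and b are positive, the least is 2a + min(2b, s + 1), the source of the minimum in the
    -- formula. If b = 0 < a, the vertices of R attain it, since s + 1 is at least 1.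
    weight-withNew : weight φ H (inside ∷ X) ≡ withNew φ ∣ X ∩ J ∣ ∣ X ∩ ∁ J ∣
    weight-withNew = go _ _ refl refl
      where
      at-new : ∀ {a} → ∣ X ∩ J ∣ ≡ a → margin H (inside ∷ X) zero ≡ 2 * a + (s + 1)
      at-new refl = margin-new X

      go : ∀ a b → ∣ X ∩ J ∣ ≡ a → ∣ X ∩ ∁ J ∣ ≡ b → weight φ H (inside ∷ X) ≡ withNew φ a b
      go zero zero ∣A∣ ∣B∣ = weight-≡ φ H (inside ∷ X) here only-new here at-new′
          (λ v∈ → ≤-reflexive (sym (trans (cong (margin H (inside ∷ X)) (≡-new v∈)) at-new′))) (cong suc (size ∣A∣ ∣B∣))
        where
        ≡-new : ∀ {v} → v ∈ inside ∷ X → v ≡ zero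
        ≡-new here        = refl
        ≡-new (there v∈X) = contradiction v∈X (∣S∣≡0⇒∉ (size ∣A∣ ∣B∣))
        only-new : ∀ {v} → v ∈ inside ∷ X → v ≡ zero ⊎ Adj H v zero
        only-new v∈ = inj₁ (≡-new v∈)
        at-new′ : margin H (inside ∷ X) zero ≡ n + 1 ∸ r
        at-new′ = begin
          margin H (inside ∷ X) zero ≡⟨ at-new ∣A∣ ⟩
          s + 1                      ≡⟨ m+n∸m≡n r (s + 1) ⟨
          r + (s + 1) ∸ r            ≡⟨ cong (_∸ r) (+-assoc r s 1) ⟨
          r + s + 1 ∸ r              ≡⟨ cong (λ k → k + 1 ∸ r) (∣∣-∁ J) ⟩
          n + 1 ∸ r                  ∎
          where open ≡-Reasoning
      go zero (suc b) ∣A∣ ∣B∣ = weight-otherwise φ H (inside ∷ X) disconnected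
        where
        disconnected : ¬ (Nonempty (inside ∷ X) × Connected H (inside ∷ X))
        disconnected (_ , conn) with ∣S∣≡suc⇒nonempty X (size ∣A∣ ∣B∣)
        -- The first edge of a walk from v₀ to u would lead into X ∩ J, which is empty.
        ... | u , u∈X with conn zero (suc u) here (there u∈X)
        ...   | (_ , there v∈X , new-l v∈J) ◅ _ = x∈∁p⇒x∉p (in-∁J ∣A∣ v∈X) v∈J
      go (suc a) zero ∣A∣ ∣B∣ with ∣S∣≡suc⇒nonempty (X ∩ J) ∣A∣
      ... | w , w∈A = weight-≡ φ H (inside ∷ X) (there w∈X) (hub-J w∈J) (there w∈X) (at-J w∈X) lower
        (cong suc size′)
        where
        w∈X = proj₁ (x∈p∩q⁻ X J w∈A)
        w∈J = proj₂ (x∈p∩q⁻ X J w∈A)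
        size′ : ∣ X ∣ ≡ suc a
        size′ = trans (size ∣A∣ ∣B∣) (+-identityʳ (suc a))
        at-J : ∀ {v} → v ∈ X → margin H (inside ∷ X) (suc v) ≡ suc (2 * suc a)
        at-J v∈X = trans (margin-with-J X v∈X (in-J ∣B∣ v∈X)) (cong (λ c → suc (2 * c)) size′)
        lower : ∀ {v} → v ∈ inside ∷ X → suc (2 * suc a) ≤ margin H (inside ∷ X) v
        lower here        = ≤-trans
          (≤-trans (≤-reflexive (+-comm 1 (2 * suc a))) (+-monoʳ-≤ (2 * suc a) (m≤n+m 1 s)))
          (≤-reflexive (sym (at-new ∣A∣)))
        lower (there v∈X) = ≤-reflexive (sym (at-J v∈X))
      go (suc a) (suc b) ∣A∣ ∣B∣ with ∣S∣≡suc⇒nonempty (X ∩ J) ∣A∣ | ∣S∣≡suc⇒nonempty (X ∩ ∁ J) ∣B∣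
      ... | w , w∈A | u , u∈B = conclude (≤-total (2 * suc b) (s + 1))
        where
        w∈X  = proj₁ (x∈p∩q⁻ X J w∈A)
        w∈J  = proj₂ (x∈p∩q⁻ X J w∈A)
        u∈X  = proj₁ (x∈p∩q⁻ X (∁ J) u∈B)
        u∈∁J = proj₂ (x∈p∩q⁻ X (∁ J) u∈B)
        k = 2 * suc a + ((2 * suc b) ⊓ (s + 1))
        double : 2 * ∣ X ∣ ≡ 2 * suc a + 2 * suc b
        double = trans (cong (2 *_) (size ∣A∣ ∣B∣)) (*-distribˡ-+ 2 (suc a) (suc b))
        k≤double : k ≤ 2 * ∣ X ∣
        k≤double = ≤-trans (+-monoʳ-≤ (2 * suc a) (m⊓n≤m (2 * suc b) (s + 1))) (≤-reflexive (sym double))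
        lower : ∀ {v} → v ∈ inside ∷ X → k ≤ margin H (inside ∷ X) v
        lower here = ≤-trans (+-monoʳ-≤ (2 * suc a) (m⊓n≤n (2 * suc b) (s + 1))) (≤-reflexive (sym (at-new ∣A∣)))
        lower {suc v} (there v∈X) with ∈-∁ J v
        ... | inj₁ v∈J  = ≤-trans (m≤n⇒m≤1+n k≤double) (≤-reflexive (sym (margin-with-J X v∈X v∈J)))
        ... | inj₂ v∈∁J = ≤-trans k≤double (≤-reflexive (sym (margin-with-∁J X v∈X v∈∁J)))
        attained : ∀ {v} → v ∈ inside ∷ X → margin H (inside ∷ X) v ≡ k →
                   weight φ H (inside ∷ X) ≡ φ (suc (suc a + suc b)) k
        attained v∈ eq = weight-≡ φ H (inside ∷ X) (there w∈X) (hub-J w∈J) v∈ eq lower (cong suc (size ∣A∣ ∣B∣))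
        conclude : 2 * suc b ≤ s + 1 ⊎ s + 1 ≤ 2 * suc b → weight φ H (inside ∷ X) ≡ φ (suc (suc a + suc b)) k
        conclude (inj₁ le) = attained (there u∈X) (trans (margin-with-∁J X u∈X u∈∁J)
          (trans double (cong (2 * suc a +_) (sym (m≤n⇒m⊓n≡m le)))))
        conclude (inj₂ ge) = attained here (trans (at-new ∣A∣) (cong (2 * suc a +_) (sym (m≥n⇒m⊓n≡n ge))))

-- Evaluation of the formula and comparison with H.

sizeSum-zero : ∀ s {ψ} → (∀ k → ψ k ≡ 0) → sizeSum s ψ ≡ 0
sizeSum-zero zero    ψ≗0 = ψ≗0 0
sizeSum-zero (suc s) ψ≗0 = cong₂ _+_ (sizeSum-zero s (ψ≗0 ∘ suc)) (sizeSum-zero s ψ≗0)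

sizeSum-split₂ : ∀ r s (F : ℕ → ℕ → ℕ) → sizeSum r (λ a → sizeSum s (F a)) ≡
  (F 0 0 + sizeSum s (onPositive (F 0))) +
  (sizeSum r (onPositive λ a → F a 0) + sizeSum r (onPositive λ a → sizeSum s (onPositive (F a))))
sizeSum-split₂ r s F = trans (sizeSum-split r _) (cong₂ _+_ (sizeSum-split s (F 0))
  (trans (sizeSum-cong r distribute) (sizeSum-distrib-+ r)))
  where
  distribute : ∀ a → onPositive (λ a → sizeSum s (F a)) a ≡
    onPositive (λ a → F a 0) a + onPositive (λ a → sizeSum s (onPositive (F a))) a
  distribute zero    = refl
  distribute (suc a) = sizeSum-split s (F (suc a))

⟦⟧-monomial-*ₚ : ∀ i j q {φ} → ⟦ x^ i y^ j *ₚ q ⟧ φ ≡ ⟦ q ⟧ λ a b → φ (i + a) (j + b)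
⟦⟧-monomial-*ₚ i j q = trans (⟦⟧-*ₚ (x^ i y^ j) q) (trans (+-identityʳ _) (*-identityˡ _))

cliqueSum : ℕ → (ℕ → ℕ → ℕ) → ℕ
cliqueSum r φ = sizeSum r (onPositive (cliqueTerm φ))

formula : ℕ → ℕ → ℕ → Poly
formula n r s =
  (const 1 +ₚ x^ 1 y^ 2) *ₚ da (complete r)
  +ₚ x^ 0 y^ 1 *ₚ da (complete s)
  +ₚ x^ 0 y^ 1 *ₚ da (complete r) *ₚ da (complete s)
  +ₚ x^ 1 y^ (n + 1 ∸ r)
  +ₚ x^ 1 y^ 1 *ₚ da (complete r)
     *ₚ ∑ₚ [1⋯ s ] (λ j → const (s C j) *ₚ x^ j y^ ((2 * j) ⊓ (s + 1)))

⟦⟧-formula : ∀ n r s φ → ⟦ formula n r s ⟧ φ ≡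
  cliqueSum r φ + cliqueSum r (λ a b → φ (1 + a) (2 + b))
  + cliqueSum s (λ a b → φ a (1 + b))
  + cliqueSum r (λ a b → cliqueSum s λ a′ b′ → φ (a + a′) (1 + b + b′))
  + φ 1 (n + 1 ∸ r)
  + cliqueSum r (λ a b → sizeSum s (onPositive λ j → φ (1 + a + j) (1 + b + (2 * j) ⊓ (s + 1))))
⟦⟧-formula n r s φ =
  trans (⟦⟧-+ₚ (t₁ +ₚ t₂ +ₚ t₃ +ₚ t₄) t₅) (cong₂ _+_
    (trans (⟦⟧-+ₚ (t₁ +ₚ t₂ +ₚ t₃) t₄) (cong₂ _+_
      (trans (⟦⟧-+ₚ (t₁ +ₚ t₂) t₃) (cong₂ _+_
        (trans (⟦⟧-+ₚ t₁ t₂) (cong₂ _+_ eval₁ eval₂))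
        eval₃))
      eval₄))
    eval₅)
  where
  open ≡-Reasoning
  Kr = da (complete r)
  Ks = da (complete s)
  binomials  = ∑ₚ [1⋯ s ] (λ j → const (s C j) *ₚ x^ j y^ ((2 * j) ⊓ (s + 1)))
  t₁ = (const 1 +ₚ x^ 1 y^ 2) *ₚ Kr
  t₂ = x^ 0 y^ 1 *ₚ Ks
  t₃ = x^ 0 y^ 1 *ₚ Kr *ₚ Ks
  t₄ = x^ 1 y^ (n + 1 ∸ r)
  t₅ = x^ 1 y^ 1 *ₚ Kr *ₚ binomials

  eval₁ : ⟦ t₁ ⟧ φ ≡ cliqueSum r φ + cliqueSum r (λ a b → φ (1 + a) (2 + b))
  eval₁ = trans (⟦⟧-*ₚ (const 1 +ₚ x^ 1 y^ 2) Kr) (cong₂ _+_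
    (trans (*-identityˡ _) (⟦⟧-da-complete r))
    (trans (+-identityʳ _) (trans (*-identityˡ _) (⟦⟧-da-complete r))))

  eval₂ : ⟦ t₂ ⟧ φ ≡ cliqueSum s (λ a b → φ a (1 + b))
  eval₂ = trans (⟦⟧-monomial-*ₚ 0 1 Ks) (⟦⟧-da-complete s)

  eval₃ : ⟦ t₃ ⟧ φ ≡ cliqueSum r (λ a b → cliqueSum s λ a′ b′ → φ (a + a′) (1 + b + b′))
  eval₃ = begin
    ⟦ t₃ ⟧ φ
      ≡⟨ ⟦⟧-*ₚ (x^ 0 y^ 1 *ₚ Kr) Ks ⟩
    ⟦ x^ 0 y^ 1 *ₚ Kr ⟧ (λ a b → ⟦ Ks ⟧ λ a′ b′ → φ (a + a′) (b + b′))
      ≡⟨ ⟦⟧-monomial-*ₚ 0 1 Kr ⟩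
    ⟦ Kr ⟧ (λ a b → ⟦ Ks ⟧ λ a′ b′ → φ (a + a′) (1 + b + b′))
      ≡⟨ ⟦⟧-cong Kr (λ a b → ⟦⟧-da-complete s) ⟩
    ⟦ Kr ⟧ (λ a b → cliqueSum s λ a′ b′ → φ (a + a′) (1 + b + b′))
      ≡⟨ ⟦⟧-da-complete r ⟩
    cliqueSum r (λ a b → cliqueSum s λ a′ b′ → φ (a + a′) (1 + b + b′)) ∎

  eval₄ : ⟦ t₄ ⟧ φ ≡ φ 1 (n + 1 ∸ r)
  eval₄ = trans (⟦⟧-monomial 1 1 (n + 1 ∸ r) {φ}) (*-identityˡ _)

  ⟦⟧-binomials : ∀ ψ → ⟦ binomials ⟧ ψ ≡ sizeSum s (onPositive λ j → ψ j ((2 * j) ⊓ (s + 1)))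
  ⟦⟧-binomials ψ = begin
    ⟦ binomials ⟧ ψ
      ≡⟨ ⟦⟧-∑ₚ [1⋯ s ] _ ⟩
    ∑ [1⋯ s ] (λ j → ⟦ const (s C j) *ₚ x^ j y^ ((2 * j) ⊓ (s + 1)) ⟧ ψ)
      ≡⟨ ∑-cong [1⋯ s ] (λ j → trans (+-identityʳ _) (cong (_* ψ j ((2 * j) ⊓ (s + 1))) (*-identityʳ (s C j)))) ⟩
    ∑ [1⋯ s ] (λ j → (s C j) * ψ j ((2 * j) ⊓ (s + 1)))
      ≡⟨ ∑-binomial s _ ⟩
    sizeSum s (onPositive λ j → ψ j ((2 * j) ⊓ (s + 1))) ∎

  eval₅ : ⟦ t₅ ⟧ φ ≡ cliqueSum r (λ a b → sizeSum s (onPositive λ j → φ (1 + a + j) (1 + b + (2 * j) ⊓ (s + 1))))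
  eval₅ = begin
    ⟦ t₅ ⟧ φ
      ≡⟨ ⟦⟧-*ₚ (x^ 1 y^ 1 *ₚ Kr) binomials ⟩
    ⟦ x^ 1 y^ 1 *ₚ Kr ⟧ (λ a b → ⟦ binomials ⟧ λ a′ b′ → φ (a + a′) (b + b′))
      ≡⟨ ⟦⟧-monomial-*ₚ 1 1 Kr ⟩
    ⟦ Kr ⟧ (λ a b → ⟦ binomials ⟧ λ a′ b′ → φ (1 + a + a′) (1 + b + b′))
      ≡⟨ ⟦⟧-cong Kr (λ a b → ⟦⟧-binomials λ a′ b′ → φ (1 + a + a′) (1 + b + b′)) ⟩
    ⟦ Kr ⟧ (λ a b → sizeSum s (onPositive λ j → φ (1 + a + j) (1 + b + (2 * j) ⊓ (s + 1))))
      ≡⟨ ⟦⟧-da-complete r ⟩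
    cliqueSum r (λ a b → sizeSum s (onPositive λ j → φ (1 + a + j) (1 + b + (2 * j) ⊓ (s + 1)))) ∎

module _ {n : ℕ} (J : Subset n) where

  private
    H = addVertex (complete n) J
    r = ∣ J ∣
    s = ∣ ∁ J ∣

  ⟦⟧-da-addVertex : ∀ φ → ⟦ da H ⟧ φ ≡ ⟦ formula n r s ⟧ φ
  ⟦⟧-da-addVertex φ = begin
    ⟦ da H ⟧ φ
      ≡⟨ ⟦⟧-da H ⟩
    ∑ (subsets (suc n)) (weight φ H)
      ≡⟨ ∑-subsets {n} (weight φ H) ⟩
    ∑ (subsets n) (weight φ H ∘ (inside Vec.∷_)) + ∑ (subsets n) (weight φ H ∘ (outside Vec.∷_))
      ≡⟨ cong₂ _+_ (∑-cong (subsets n) (weight-withNew J φ)) (∑-cong (subsets n) (weight-withoutNew J φ)) ⟩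
    ∑ (subsets n) (λ X → withNew J φ ∣ X ∩ J ∣ ∣ X ∩ ∁ J ∣) +
    ∑ (subsets n) (λ X → withoutNew J φ ∣ X ∩ J ∣ ∣ X ∩ ∁ J ∣)
      ≡⟨ cong₂ _+_ (∑-subsets-split J (withNew J φ)) (∑-subsets-split J (withoutNew J φ)) ⟩
    sizeSum r (λ a → sizeSum s (withNew J φ a)) + sizeSum r (λ a → sizeSum s (withoutNew J φ a))
      ≡⟨ cong₂ _+_ (sizeSum-split₂ r s (withNew J φ)) (sizeSum-split₂ r s (withoutNew J φ)) ⟩
    ((c₄ + sizeSum s (onPositive (withNew J φ 0)))
      + (sizeSum r (onPositive λ a → withNew J φ a 0)
         + sizeSum r (onPositive λ a → sizeSum s (onPositive (withNew J φ a)))))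
    + ((0 + sizeSum s (onPositive (withoutNew J φ 0)))
      + (sizeSum r (onPositive λ a → withoutNew J φ a 0)
         + sizeSum r (onPositive λ a → sizeSum s (onPositive (withoutNew J φ a)))))
      ≡⟨ cong₂ _+_
           (cong₂ _+_ (cong (c₄ +_) (sizeSum-zero s λ { zero → refl ; (suc _) → refl }))
             (cong₂ _+_ (sizeSum-cong r (onPositive-cong λ _ → refl))
                        (sizeSum-cong r (onPositive-cong λ a → sizeSum-cong s (onPositive-cong λ b → refl)))))
           (cong₂ _+_ (sizeSum-cong s (onPositive-cong λ _ → refl))
             (cong₂ _+_ (sizeSum-cong r (onPositive-cong λ a → cong (cliqueTerm φ) (+-identityʳ (suc a))))
                        (sizeSum-cong r (onPositive-cong λ a → sizeSum-cong s (onPositive-cong λ b →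
                           cong (φ (suc a + suc b)) (exponent a b)))))) ⟩
    -- With v₀: c₄ is the set {v₀}, the 0 stands for the disconnected sets of v₀ and vertices of S,
    -- c₁′ has only vertices of R besides v₀, and c₅ has both kinds. Without v₀: c₂ collects the
    -- sets inside S, c₁ those inside R and c₃ those meeting both.
    ((c₄ + 0) + (c₁′ + c₅)) + (c₂ + (c₁ + c₃))
      ≡⟨ reorder c₁ c₁′ c₂ c₃ c₄ c₅ ⟩
    c₁ + c₁′ + c₂ + c₃ + c₄ + c₅
      ≡⟨ ⟦⟧-formula n r s φ ⟨
    ⟦ formula n r s ⟧ φ ∎
    where
    open ≡-Reasoning
    c₁  = cliqueSum r φ
    c₁′ = cliqueSum r (λ a b → φ (1 + a) (2 + b))
    c₂  = cliqueSum s (λ a b → φ a (1 + b))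
    c₃  = cliqueSum r (λ a b → cliqueSum s λ a′ b′ → φ (a + a′) (1 + b + b′))
    c₄  = φ 1 (n + 1 ∸ r)
    c₅  = cliqueSum r (λ a b → sizeSum s (onPositive λ j → φ (1 + a + j) (1 + b + (2 * j) ⊓ (s + 1))))

    -- The identity 2(p + q) - 1 = 1 + (2p - 1) + (2q - 1) at p = a + 1 and q = b + 1; its summand 1
    -- is the factor y in front of the product of the two clique polynomials.
    exponent : ∀ a b → a + suc b + suc (a + suc b + 0) ≡ suc (a + suc (a + 0) + (b + suc (b + 0)))
    exponent = solve-∀

    reorder : ∀ c₁ c₁′ c₂ c₃ c₄ c₅ →
      ((c₄ + 0) + (c₁′ + c₅)) + (c₂ + (c₁ + c₃)) ≡ c₁ + c₁′ + c₂ + c₃ + c₄ + c₅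
    reorder = solve-∀

  da-addVertex : da H ≈ₚ formula n r s
  da-addVertex i j = trans (coeff-⟦⟧ (da H) i j)
    (trans (⟦⟧-da-addVertex (monomialIndicator i j)) (sym (coeff-⟦⟧ (formula n r s) i j)))

-- The coefficients of x and the degree sequence.

indicator-yes : {P : Set} (P? : Dec P) → P → indicator P? ≡ 1
indicator-yes (yes _) p = refl
indicator-yes (no ¬p) p = contradiction p ¬p

indicator-no : {P : Set} (P? : Dec P) → ¬ P → indicator P? ≡ 0
indicator-no (yes p) ¬p = contradiction p ¬p
indicator-no (no _)  ¬p = refl

indicator-cong : {P Q : Set} (P? : Dec P) (Q? : Dec Q) → (P → Q) → (Q → P) → indicator P? ≡ indicator Q?
indicator-cong (yes p) Q? P→Q Q→P = sym (indicator-yes Q? (P→Q p))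
indicator-cong (no ¬p) Q? P→Q Q→P = sym (indicator-no Q? (¬p ∘ Q→P))

monomialIndicator-diag : ∀ i j b → monomialIndicator i j i b ≡ indicator (b ≟ j)
monomialIndicator-diag i j b = indicator-cong ((i ≟ i) ×-dec (b ≟ j)) (b ≟ j) proj₂ (refl ,_)

∑-subsets-⊥ : (F : Subset n → ℕ) → (∀ S → ∣ S ∣ ≢ 0 → F S ≡ 0) → ∑ (subsets n) F ≡ F ⊥
∑-subsets-⊥ {zero}  F F≗0 = +-identityʳ _
∑-subsets-⊥ {suc n} F F≗0 = trans (∑-subsets {n} F) (cong₂ _+_
  (∑-zero (subsets n) (λ S → F≗0 (inside Vec.∷ S) λ ()))
  (∑-subsets-⊥ (F ∘ (outside Vec.∷_)) (λ S → F≗0 (outside Vec.∷ S))))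

∑-subsets-⁅⁆ : (F : Subset n → ℕ) → (∀ S → ∣ S ∣ ≢ 1 → F S ≡ 0) → ∑ (subsets n) F ≡ ∑Fin (F ∘ ⁅_⁆)
∑-subsets-⁅⁆ {zero}  F F≗0 = trans (+-identityʳ _) (F≗0 Vec.[] λ ())
∑-subsets-⁅⁆ {suc n} F F≗0 = trans (∑-subsets {n} F) (cong₂ _+_
  (∑-subsets-⊥ (F ∘ (inside Vec.∷_)) (λ S ∣S∣≢0 → F≗0 (inside Vec.∷ S) (∣S∣≢0 ∘ suc-injective)))
  (∑-subsets-⁅⁆ (F ∘ (outside Vec.∷_)) (λ S → F≗0 (outside Vec.∷ S))))

module _ (G : Graph n) {u v : Fin n} where

  ∈-neighbourhood⁺ : Adj G u v → v ∈ neighbourhood G u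
  ∈-neighbourhood⁺ p = lookup⇒[]= v _ (trans (lookup∘tabulate _ v) (dec-true (adj? G u v) p))

  ∈-neighbourhood⁻ : v ∈ neighbourhood G u → Adj G u v
  ∈-neighbourhood⁻ v∈N with adj? G u v | trans (sym (lookup∘tabulate (λ v → does (adj? G u v)) v)) ([]=⇒lookup v∈N)
  ... | yes p | _ = p
  ... | no _  | ()

module _ (G : Graph n) where

  margin-⁅⁆ : ∀ u → margin G ⁅ u ⁆ u ≡ n ∸ deg G u
  margin-⁅⁆ u = margin-≡ G ⁅ u ⁆ u
    (trans (m+[n∸m]≡n (∣p∣≤n (neighbourhood G u))) (cong (λ d → d + (d + n)) (sym δ≡0)))
    where
    δ≡0 : δ G ⁅ u ⁆ u ≡ 0
    δ≡0 = trans (cong ∣_∣ (Empty-unique λ (v , v∈) →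
            let v∈⁅u⁆ , v∈N = x∈p∩q⁻ ⁅ u ⁆ (neighbourhood G u) v∈ in
            adj-irrefl G (sym (x∈⁅y⁆⇒x≡y u v∈⁅u⁆)) (∈-neighbourhood⁻ G v∈N)))
          (∣⊥∣≡0 n)

  weight-⁅⁆ : ∀ φ u → weight φ G ⁅ u ⁆ ≡ φ 1 (n ∸ deg G u)
  weight-⁅⁆ φ u = weight-≡ φ G ⁅ u ⁆ (x∈⁅x⁆ u) (inj₁ ∘ x∈⁅y⁆⇒x≡y u) (x∈⁅x⁆ u) (margin-⁅⁆ u)
    (λ v∈ → ≤-reflexive (sym (trans (cong (margin G ⁅ u ⁆) (x∈⁅y⁆⇒x≡y u v∈)) (margin-⁅⁆ u)))) (∣⁅x⁆∣≡1 u)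

  coeff-da-1 : ∀ j → coeff (da G) 1 j ≡ ∑Fin (λ u → indicator ((n ∸ deg G u) ≟ j))
  coeff-da-1 j = begin
    coeff (da G) 1 j                                   ≡⟨ coeff-⟦⟧ (da G) 1 j ⟩
    ⟦ da G ⟧ φ                                         ≡⟨ ⟦⟧-da G ⟩
    ∑ (subsets n) (weight φ G)                         ≡⟨ ∑-subsets-⁅⁆ (weight φ G) vanishing ⟩
    ∑Fin (weight φ G ∘ ⁅_⁆)                            ≡⟨ sum-cong-≗ +-0-commutativeMonoid (λ u →
                                                            trans (weight-⁅⁆ φ u) (monomialIndicator-diag 1 j _)) ⟩
    ∑Fin (λ u → indicator ((n ∸ deg G u) ≟ j))         ∎
    where
    open ≡-Reasoning
    φ = monomialIndicator 1 j
    vanishing : ∀ S → ∣ S ∣ ≢ 1 → weight φ G S ≡ 0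
    vanishing S ∣S∣≢1 with nonempty? S ×-dec connected? G S
    ... | yes (ne , conn) = trans (weight-connected φ G S ne conn) (indicator-no ((∣ S ∣ ≟ 1) ×-dec (f-y G S ≟ j)) (∣S∣≢1 ∘ proj₁))
    ... | no ¬p = weight-otherwise φ G S ¬p

∑Fin-indicator-no : (g : Fin n → ℕ) {j : ℕ} → (∀ v → g v ≢ j) → ∑Fin (λ v → indicator (g v ≟ j)) ≡ 0
∑Fin-indicator-no {n} g g≢j = trans
  (sum-cong-≗ +-0-commutativeMonoid (λ v → indicator-no (g v ≟ _) (g≢j v)))
  (sum-replicate-zero +-0-commutativeMonoid n)

∑Fin-indicator-head : (g : Fin (suc n) → ℕ) → ∑Fin (λ v → indicator (g v ≟ g zero)) ≢ 0
∑Fin-indicator-head g eq with trans (sym eq)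
  (cong (_+ ∑Fin (λ v → indicator (g (suc v) ≟ g zero))) (indicator-yes (g zero ≟ g zero) refl))
... | ()

-- The value at `zero` occurs among the values of g because its count is positive. Deleting `zero`
-- and one such k lowers the same count on both sides, so the induction continues. Equality of m and
-- n is a result here and not an assumption.
equidistributed⇒permutation : (f : Fin m → ℕ) (g : Fin n → ℕ) →
  (∀ j → ∑Fin (λ u → indicator (f u ≟ j)) ≡ ∑Fin (λ v → indicator (g v ≟ j))) →
  ∃ λ (π : Permutation m n) → ∀ u → f u ≡ g (π ⟨$⟩ʳ u)
equidistributed⇒permutation {zero} {zero} f g eq = Perm.id , λ ()
equidistributed⇒permutation {zero} {suc n} f g eq =
  contradiction (sym (eq (g zero))) (∑Fin-indicator-head g)
equidistributed⇒permutation {suc m} {n} f g eq with Fin.any? (λ v → g v ≟ f zero)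
... | no ¬∃ = contradiction
  (trans (eq (f zero)) (∑Fin-indicator-no g (λ v gv≡f0 → ¬∃ (v , gv≡f0)))) (∑Fin-indicator-head f)
equidistributed⇒permutation {suc m} {suc n} f g eq | yes (k , gk≡f0) = Perm.insert zero k π , match
  where
  rest : ∀ j → ∑Fin (λ u → indicator (f (suc u) ≟ j)) ≡ ∑Fin (λ v → indicator (g (punchIn k v) ≟ j))
  rest j = +-cancelˡ-≡ (indicator (f zero ≟ j)) _ _ (trans (eq j)
    (trans (sum-remove +-0-commutativeMonoid {i = k} (λ v → indicator (g v ≟ j)))
           (cong (λ c → indicator (c ≟ j) + ∑Fin (λ v → indicator (g (punchIn k v) ≟ j))) gk≡f0)))
  IH = equidistributed⇒permutation (f ∘ suc) (g ∘ punchIn k) rest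
  π  = proj₁ IH

  match : ∀ u → f u ≡ g (Perm.insert zero k π ⟨$⟩ʳ u)
  match zero    = sym gk≡f0
  match (suc u) = trans (proj₂ IH u) (cong g (sym (Perm.insert-punchIn zero k π u)))

-- Recovering H from its degrees.

adj-⊆∧deg-≡⇒⊇ : (G H : Graph n) (u : Fin n) → deg G u ≡ deg H u →
  (∀ {v} → Adj G u v → Adj H u v) → (∀ {v} → Adj H u v → Adj G u v)
adj-⊆∧deg-≡⇒⊇ G H u deg≡ G⊆H {v} p with adj? G u v
... | yes q = q
... | no ¬q = contradiction (p⊂q⇒∣p∣<∣q∣
  ((λ w∈ → ∈-neighbourhood⁺ H (G⊆H (∈-neighbourhood⁻ G w∈))) ,
   v , ∈-neighbourhood⁺ H p , ¬q ∘ ∈-neighbourhood⁻ G))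
  (<-irrefl deg≡)

module _ (J : Subset n) (G : Graph (suc n)) where

  private
    H = addVertex (complete n) J

  -- Vertices of J have full degree in H, hence also in G; so the neighbours of
  -- zero in G include J and, by counting, are exactly J.  The remaining vertices
  -- then have as many neighbours in G as are still possible.
  deg-≡⇒adj-⇔ : (∀ u → deg G u ≡ deg H u) → ∀ u v → Adj G u v ⇔ Adj H u v
  deg-≡⇒adj-⇔ deg≡ zero    v = mk⇔ new⊆ new⊇
    where
    J-⊆ : ∀ {u} → u ∈ J → ∀ {v} → Adj G (suc u) v → Adj H (suc u) v
    J-⊆ u∈J {zero}  p = new-r u∈J
    J-⊆ u∈J {suc v} p = old λ u≡v → adj-irrefl G (cong suc u≡v) p

    new⊇ : ∀ {v} → Adj H zero v → Adj G zero v
    new⊇ (new-l v∈J) = adj-sym G (adj-⊆∧deg-≡⇒⊇ G H _ (deg≡ _) (J-⊆ v∈J) (new-r v∈J))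

    new⊆ : ∀ {v} → Adj G zero v → Adj H zero v
    new⊆ = adj-⊆∧deg-≡⇒⊇ H G zero (sym (deg≡ zero)) new⊇
  deg-≡⇒adj-⇔ deg≡ (suc u) v = mk⇔ old⊆ (adj-⊆∧deg-≡⇒⊇ G H (suc u) (deg≡ (suc u)) old⊆)
    where
    old⊆ : ∀ {v} → Adj G (suc u) v → Adj H (suc u) v
    old⊆ {zero}  p = adj-sym H (Equivalence.to (deg-≡⇒adj-⇔ deg≡ zero (suc u)) (adj-sym G p))
    old⊆ {suc v} p = old λ u≡v → adj-irrefl G (cong suc u≡v) p

module _ (π : Permutation m n) (G : Graph m) where

  -- Carries G onto the vertex set of H, so that `deg-≡⇒adj-⇔` can compare the two graphs vertex by
  -- vertex.
  relabel : Graph n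
  relabel = record
    { Adj        = λ u v → Adj G (π ⟨$⟩ˡ u) (π ⟨$⟩ˡ v)
    ; adj?       = λ u v → adj? G (π ⟨$⟩ˡ u) (π ⟨$⟩ˡ v)
    ; adj-sym    = adj-sym G
    ; adj-irrefl = adj-irrefl G ∘ cong (π ⟨$⟩ˡ_)
    }

  relabel-≅ : G ≅ relabel
  relabel-≅ = record
    { bijection = π
    ; adj-iff   = λ u v → mk⇔ (subst₂ (Adj G) (sym (inverseˡ π)) (sym (inverseˡ π)))
                              (subst₂ (Adj G) (inverseˡ π) (inverseˡ π))
    }

  deg-relabel : {H : Graph n} → (∀ u → deg G u ≡ deg H (π ⟨$⟩ʳ u)) → ∀ v → deg relabel v ≡ deg H v
  deg-relabel {H} deg-matched v = begin
    deg relabel v                    ≡⟨ cong (deg relabel) (inverseʳ π) ⟨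
    deg relabel (π ⟨$⟩ʳ (π ⟨$⟩ˡ v))  ≡⟨ deg-≅ relabel-≅ (π ⟨$⟩ˡ v) ⟨
    deg G (π ⟨$⟩ˡ v)                 ≡⟨ deg-matched (π ⟨$⟩ˡ v) ⟩
    deg H (π ⟨$⟩ʳ (π ⟨$⟩ˡ v))        ≡⟨ cong (deg H) (inverseʳ π) ⟩
    deg H v                          ∎
    where open ≡-Reasoning

  relabel-adj-⇔⇒≅ : {H : Graph n} → (∀ u v → Adj relabel u v ⇔ Adj H u v) → G ≅ H
  relabel-adj-⇔⇒≅ same = record
    { bijection = π
    ; adj-iff   = λ u v → same (π ⟨$⟩ʳ u) (π ⟨$⟩ʳ v) ⇔-∘ _≅_.adj-iff relabel-≅ u v
    }

da-≈⇒deg-matching : (G : Graph m) (H : Graph n) → da G ≈ₚ da H →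
  ∃ λ (π : Permutation m n) → ∀ u → deg G u ≡ deg H (π ⟨$⟩ʳ u)
da-≈⇒deg-matching {m} {n} G H da≈ = π , λ u →
  -- The matching equates m - deg u with n - deg of its image. Once m ≡ n is known, truncated
  -- subtraction can be cancelled because no degree exceeds the order.
  ∸-cancelˡ-≡ (∣p∣≤n (neighbourhood G u))
    (subst (deg H (π ⟨$⟩ʳ u) ≤_) (sym m≡n) (∣p∣≤n (neighbourhood H (π ⟨$⟩ʳ u))))
    (trans (proj₂ matched u) (cong (_∸ deg H (π ⟨$⟩ʳ u)) (sym m≡n)))
  where
  matched = equidistributed⇒permutation (λ u → m ∸ deg G u) (λ v → n ∸ deg H v)
    λ j → trans (sym (coeff-da-1 G j)) (trans (da≈ 1 j) (coeff-da-1 H j))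
  π = proj₁ matched
  m≡n = Perm.↔⇒≡ π

da-≈⇒≅ : (J : Subset n) (G : Graph m) → da G ≈ₚ da (addVertex (complete n) J) → G ≅ addVertex (complete n) J
da-≈⇒≅ {n} J G da≈ = relabel-adj-⇔⇒≅ π G {H}
  (deg-≡⇒adj-⇔ J (relabel π G) (deg-relabel π G {H} (proj₂ matching-π)))
  where
  H = addVertex (complete n) J
  matching-π = da-≈⇒deg-matching G H da≈
  π = proj₁ matching-π

-- The equivalence.

≅⇒da-≈ : {G : Graph m} {H : Graph n} → G ≅ H → da G ≈ₚ da H
≅⇒da-≈ {G = G} {H} i a b = trans (coeff-⟦⟧ (da G) a b)
  (trans (⟦⟧-da-≅ i (monomialIndicator a b)) (sym (coeff-⟦⟧ (da H) a b)))

-- The theorem reads R and S off the graph H, whereas the computations use `J` and `∁ J`; this lemma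
-- and the next identify their sizes.
∣neighbourhood-new∣ : (J : Subset n) → ∣ neighbourhood (addVertex (complete n) J) zero ∣ ≡ ∣ J ∣
∣neighbourhood-new∣ J = cong ∣_∣ (neighbourhood-new J)

∣non-neighbours-new∣ : (J : Subset n) →
  ∣ ∁ (neighbourhood (addVertex (complete n) J) zero ∪ ⁅ zero ⁆) ∣ ≡ ∣ ∁ J ∣
∣non-neighbours-new∣ J = trans (cong (λ R → ∣ ∁ (R ∪ ⁅ zero ⁆) ∣) (neighbourhood-new J))
  (cong (∣_∣ ∘ ∁) (∪-identityʳ J))

-- The polynomial arrives as a variable p with an equation, so matching on `refl` never has to
-- compare two large closed expressions.
≅⇔da-≈-formula : (J : Subset n) (G : Graph m) {r s : ℕ} {p : Poly} →
  r ≡ ∣ J ∣ → s ≡ ∣ ∁ J ∣ → formula n r s ≡ p → (G ≅ addVertex (complete n) J) ⇔ (da G ≈ₚ p)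
≅⇔da-≈-formula J G refl refl refl = mk⇔
  (λ i a b → trans (≅⇒da-≈ i a b) (da-addVertex J a b))
  (λ da≈ → da-≈⇒≅ J G λ a b → trans (da≈ a b) (sym (da-addVertex J a b)))

-- A cheap refl only while r and s are variables: at ∣ R ∣ and ∣ S ∣ the conversion
-- check would start evaluating the polynomials.
formula-unfolded : ∀ n r s → formula n r s ≡
  (const 1 +ₚ x^ 1 y^ 2) *ₚ da (complete r)
  +ₚ x^ 0 y^ 1 *ₚ da (complete s)
  +ₚ x^ 0 y^ 1 *ₚ da (complete r) *ₚ da (complete s)
  +ₚ x^ 1 y^ (n + 1 ∸ r)
  +ₚ x^ 1 y^ 1 *ₚ da (complete r)
     *ₚ ∑ₚ [1⋯ s ] (λ j → const (s C j) *ₚ x^ j y^ ((2 * j) ⊓ (s + 1)))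
formula-unfolded n r s = refl

proposition41 : ∀ (n : ℕ) .{{_ : NonZero n}} (J : Subset n) {m : ℕ} (G : Graph m) →
  let H  = addVertex (complete n) J
      v₀ = zero
      R  = neighbourhood H v₀
      S  = ∁ (R ∪ ⁅ v₀ ⁆)
      r  = ∣ R ∣
      s  = ∣ S ∣
  in (G ≅ H) ⇔
     (da G ≈ₚ
        (const 1 +ₚ x^ 1 y^ 2) *ₚ da (complete r)
        +ₚ x^ 0 y^ 1 *ₚ da (complete s)
        +ₚ x^ 0 y^ 1 *ₚ da (complete r) *ₚ da (complete s)
        +ₚ x^ 1 y^ (n + 1 ∸ r)
        +ₚ x^ 1 y^ 1 *ₚ da (complete r)
             *ₚ ∑ₚ [1⋯ s ] (λ j → const (s C j) *ₚ x^ j y^ ((2 * j) ⊓ (s + 1))))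
proposition41 n J G =
  ≅⇔da-≈-formula J G (∣neighbourhood-new∣ J) (∣non-neighbours-new∣ J)
    (formula-unfolded n ∣ R ∣ ∣ ∁ (R ∪ ⁅ zero ⁆) ∣)
  where R = neighbourhood (addVertex (complete n) J) zero
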